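{- Let $p>1$ and $n\ge 3p+1$ be integers and let $k=\left\lfloor \frac{n+p-1}{2p}\right\rfloor$. Then \[ R(H_{2p+1,2n}) = C(H_{2p+1,2n}) - 2 + (k+2)2^{ -k}. \]
   Context: For a finite simple undirected graph $G$, the closeness is $C(G)=\sum_{i}\sum_{j\ne i}2^{ -d(i,j)}$, where the sum is over all ordered pairs of distinct vertices, $d(i,j)$ is the graph distance, and $2^{ -d(i,j)}=0$ if $i$ and $j$ lie in different components. The link residual closeness is $R(G)=\min_{(r,s)} C(G_{r,s})$, where the minimum is over all edges (links) $(r,s)$ of $G$ and $G_{r,s}$ is the graph obtained from $G$ by deleting the edge $(r,s)$ (keeping all vertices). For integers $p\ge 1$ and $n\ge p+1$, the Harary graph $H_{2p+1,2n}$ has vertices $1,2,\dots,2n$ placed in a circle in this order, each vertex being joined to the nearest $p$ vertices in each direction along the circle and to the diametrically opposite vertex (so $i\ne j$ are adjacent iff $i-j\equiv\pm t \pmod{2n}$ for some $t\in\{1,\dots,p\}$ or $i-j\equiv n\pmod{2n}$). -}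

module Defs where

open import Algebra.Bundles using (CommutativeRing)
import Algebra.Properties.CommutativeMonoid.Sum as CommutativeMonoidSum
import Algebra.Properties.Semiring.Exp as SemiringExp
open import Data.Bool.Base using (if_then_else_)
open import Data.Fin.Base using (Fin; zero; suc; toℕ)
import Data.Fin.Properties as Fin
open import Data.Integer.Base as ℤ using (ℤ; +_)
import Data.Integer.Divisibility.Signed as ℤ
import Data.Integer.Properties as ℤ
open import Data.Integer.Tactic.RingSolver using (solve-∀)
open import Data.List.Base using (List; []; _∷_; map; filter; allFin; cartesianProduct)
import Data.List.Extrema as Extrema
open import Data.Nat.Base using (ℕ; zero; suc; _≤_; _<_; _>_; _∸_; NonZero; s≤s; s≤s⁻¹; z<s; >-nonZero)
import Data.Nat.Base as ℕ
open import Data.Nat.Induction using (<-rec)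
import Data.Nat.Properties as ℕ
open import Data.Product.Base using (∃; _×_; _,_)
open import Data.Rational.Base using (ℚ; 0ℚ; ½)
import Data.Rational.Properties as ℚ
open import Data.Sum.Base using (_⊎_; inj₁; inj₂)
open import Relation.Binary.Bundles using (DecTotalOrder)
open import Relation.Binary.Definitions using (Decidable; Irreflexive; Symmetric)
open import Relation.Binary.PropositionalEquality
  using (_≡_; _≢_; refl; sym; trans; cong; subst)
open import Relation.Nullary using (¬_; Dec; yes; no; does; contradiction)
open import Relation.Nullary.Decidable using (map′; ¬?; _×-dec_; _⊎-dec_)

open CommutativeMonoidSum ℚ.+-0-commutativeMonoid using (sum)
open SemiringExp (CommutativeRing.semiring ℚ.+-*-commutativeRing) using (_^_)

record Graph (N : ℕ) : Set₁ where
  field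
    Adj    : Fin N → Fin N → Set
    adj?   : Decidable Adj
    irrefl : Irreflexive _≡_ Adj
    symm   : Symmetric Adj

open Graph

deleteLink : ∀ {N} → Graph N → Fin N → Fin N → Graph N
deleteLink {N} G r s = record
  { Adj    = λ i j → Adj G i j × ¬ IsRS i j
  ; adj?   = λ i j → adj? G i j ×-dec ¬? (isRS? i j)
  ; irrefl = λ i≡j (a , _) → irrefl G i≡j a
  ; symm   = λ (a , ¬rs) → symm G a , λ rs → ¬rs (swapRS rs)
  }
  where
  IsRS : Fin N → Fin N → Set
  IsRS i j = (i ≡ r × j ≡ s) ⊎ (i ≡ s × j ≡ r)

  isRS? : Decidable IsRS
  isRS? i j = ((i Fin.≟ r) ×-dec (j Fin.≟ s)) ⊎-dec ((i Fin.≟ s) ×-dec (j Fin.≟ r))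

  swapRS : ∀ {i j} → IsRS i j → IsRS j i
  swapRS (inj₁ (a , b)) = inj₂ (b , a)
  swapRS (inj₂ (a , b)) = inj₁ (b , a)

data Walk {N} (G : Graph N) : ℕ → Fin N → Fin N → Set where
  []  : ∀ {i} → Walk G 0 i i
  _∷_ : ∀ {d i j k} → Adj G i j → Walk G d j k → Walk G (suc d) i k

IsDistance : ∀ {N} → Graph N → Fin N → Fin N → ℕ → Set
IsDistance G i j d = Walk G d i j × (∀ {m} → Walk G m i j → d ≤ m)

module _ {N} (G : Graph N) where

  private
    walk? : ∀ d i j → Dec (Walk G d i j)
    walk? zero i j = map′ (λ { refl → [] }) (λ { [] → refl }) (i Fin.≟ j)
    walk? (suc d) i k =
      map′ (λ (_ , a , w) → a ∷ w) (λ { (a ∷ w) → _ , a , w })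
           (Fin.any? λ j → adj? G i j ×-dec walk? d j k)

    vertex : ∀ {d i j} → Walk G d i j → Fin (suc d) → Fin N
    vertex {i = i} w zero    = i
    vertex (a ∷ w)   (suc x) = vertex w x

    prefix : ∀ {d i j} (w : Walk G d i j) x → Walk G (toℕ x) i (vertex w x)
    prefix w       zero    = []
    prefix (a ∷ w) (suc x) = a ∷ prefix w x

    suffix : ∀ {d i j} (w : Walk G d i j) x → Walk G (d ∸ toℕ x) (vertex w x) j
    suffix w       zero    = w
    suffix (a ∷ w) (suc x) = suffix w x

    _++_ : ∀ {d e i j k} → Walk G d i j → Walk G e j k → Walk G (d ℕ.+ e) i k
    []      ++ v = v
    (a ∷ w) ++ v = a ∷ (w ++ v)

    cut : ∀ {d i j} → N ≤ d → Walk G d i j → ∃ λ e → e < d × Walk G e i j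
    cut {d} N≤d w with x , y , x<y , eq ← Fin.pigeonhole (s≤s N≤d) (vertex w) =
      toℕ x ℕ.+ (d ∸ toℕ y) , shorter ,
      prefix w x ++ subst (λ v → Walk G (d ∸ toℕ y) v _) (sym eq) (suffix w y)
      where
      shorter : toℕ x ℕ.+ (d ∸ toℕ y) < d
      shorter = subst (toℕ x ℕ.+ (d ∸ toℕ y) <_)
        (ℕ.m+[n∸m]≡n (s≤s⁻¹ (Fin.toℕ<n y)))
        (ℕ.+-monoˡ-< (d ∸ toℕ y) x<y)

    shorten : ∀ {i j} d → Walk G d i j → ∃ λ e → e < N × Walk G e i j
    shorten = <-rec _ λ d rec w → case d rec w
      where
      case : ∀ {i j} d → (∀ {e} → e < d → Walk G e i j → ∃ λ f → f < N × Walk G f i j) →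
             Walk G d i j → ∃ λ e → e < N × Walk G e i j
      case d rec w with d ℕ.<? N
      ... | yes d<N = d , d<N , w
      ... | no  d≮N with e , e<d , v ← cut (ℕ.≮⇒≥ d≮N) w = rec e<d v

    least : ∀ {i j} d → Walk G d i j → ∃ (IsDistance G i j)
    least {i} {j} = <-rec _ λ d rec w → case d rec w
      where
      case : ∀ d → (∀ {e} → e < d → Walk G e i j → ∃ (IsDistance G i j)) →
             Walk G d i j → ∃ (IsDistance G i j)
      case d rec w with ℕ.anyUpTo? (λ e → walk? e i j) d
      ... | yes (e , e<d , v) = rec e<d v
      ... | no  ∄e            = d , w , λ {m} v → ℕ.≮⇒≥ λ m<d → ∄e (m , m<d , v)

  distance? : ∀ i j → ∃ (IsDistance G i j) ⊎ (∀ d → ¬ Walk G d i j)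
  distance? i j with ℕ.anyUpTo? (λ e → walk? e i j) N
  ... | yes (d , _ , w) = inj₁ (least d w)
  ... | no  ∄e          = inj₂ λ d w → ∄e (shorten d w)

2^-_ : ℕ → ℚ
2^- d = ½ ^ d

-- 2^(-d(i,j)), read as 0 when no walk joins i to j.
weight : ∀ {N} → Graph N → Fin N → Fin N → ℚ
weight G i j with distance? G i j
... | inj₁ (d , _) = 2^- d
... | inj₂ _       = 0ℚ

C : ∀ {N} → Graph N → ℚ
C G = sum λ i → sum λ j → if does (i Fin.≟ j) then 0ℚ else weight G i j

-- Every undirected link occurs twice, once in each orientation.
links : ∀ {N} → Graph N → List (Fin N × Fin N)
links {N} G = filter (λ (r , s) → adj? G r s) (cartesianProduct (allFin N) (allFin N))

-- The empty list has no minimum; the value 0 is a convention. It makes R 0 on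
-- graphs without links, which a Harary graph with p ≥ 1 and n ≥ p + 1 is not.
minimum : List ℚ → ℚ
minimum []       = 0ℚ
minimum (x ∷ xs) = Extrema.min (DecTotalOrder.totalOrder ℚ.≤-decTotalOrder) x xs

R : ∀ {N} → Graph N → ℚ
R G = minimum (map (λ (r , s) → C (deleteLink G r s)) (links G))

_≡_[mod_] : ℤ → ℤ → ℕ → Set
a ≡ b [mod m ] = (+ m) ℤ.∣ (a ℤ.- b)

private
  ≡mod? : ∀ m a b → Dec (a ≡ b [mod m ])
  ≡mod? m a b = (+ m) ℤ.∣? (a ℤ.- b)

  neg-mod : ∀ {m x y} b → (x ℤ.- y) ≡ b [mod m ] → (y ℤ.- x) ≡ ℤ.- b [mod m ]
  neg-mod {m} {x} {y} b h = subst ((+ m) ℤ.∣_) (eq x y b) (ℤ.∣m⇒∣-m h)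
    where
    eq : ∀ x y b → ℤ.- ((x ℤ.- y) ℤ.- b) ≡ (y ℤ.- x) ℤ.- (ℤ.- b)
    eq = solve-∀

  neg-mod⁻ : ∀ {m x y} b → (x ℤ.- y) ≡ ℤ.- b [mod m ] → (y ℤ.- x) ≡ b [mod m ]
  neg-mod⁻ {m} {x} {y} b h =
    subst (λ c → (y ℤ.- x) ≡ c [mod m ]) (ℤ.neg-involutive b) (neg-mod {m} {x} {y} (ℤ.- b) h)

  antipode-mod : ∀ n {x y} → (x ℤ.- y) ≡ + n [mod 2 ℕ.* n ] → (y ℤ.- x) ≡ + n [mod 2 ℕ.* n ]
  antipode-mod n {x} {y} h =
    subst ((+ (2 ℕ.* n)) ℤ.∣_)
      (trans (cong (λ z → (ℤ.- ((x ℤ.- y) ℤ.- + n)) ℤ.- z) (ℤ.pos-* 2 n)) (eq x y (+ n)))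
      (ℤ.∣m∣n⇒∣m-n (ℤ.∣m⇒∣-m h) ℤ.∣-refl)
    where
    eq : ∀ x y b → ℤ.- ((x ℤ.- y) ℤ.- b) ℤ.- (+ 2 ℤ.* b) ≡ (y ℤ.- x) ℤ.- b
    eq = solve-∀

-- Vertices are numbered from 0 rather than 1; only the differences i - j matter.
_⊖_ : ∀ {N} → Fin N → Fin N → ℤ
i ⊖ j = + toℕ i ℤ.- + toℕ j

module _ (p n : ℕ) where

  Near : Fin (2 ℕ.* n) → Fin (2 ℕ.* n) → Set
  Near i j = ∃ λ t → (1 ≤ t × t ≤ p) ×
    ((i ⊖ j) ≡ + t [mod 2 ℕ.* n ] ⊎
     (i ⊖ j) ≡ ℤ.- (+ t) [mod 2 ℕ.* n ])

  Opposite : Fin (2 ℕ.* n) → Fin (2 ℕ.* n) → Set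
  Opposite i j = (i ⊖ j) ≡ + n [mod 2 ℕ.* n ]

  private
    near? : Decidable Near
    near? i j = map′
      (λ (t , t<1+p , 1≤t , h) → t , (1≤t , s≤s⁻¹ t<1+p) , h)
      (λ (t , (1≤t , t≤p) , h) → t , s≤s t≤p , 1≤t , h)
      (ℕ.anyUpTo? (λ t → (1 ℕ.≤? t) ×-dec
        (≡mod? (2 ℕ.* n) (i ⊖ j) (+ t) ⊎-dec ≡mod? (2 ℕ.* n) (i ⊖ j) (ℤ.- (+ t)))) (suc p))

    near-sym : Symmetric Near
    near-sym {i} {j} (t , b , inj₁ h) = t , b , inj₂ (neg-mod  {x = + toℕ i} {+ toℕ j} (+ t) h)
    near-sym {i} {j} (t , b , inj₂ h) = t , b , inj₁ (neg-mod⁻ {x = + toℕ i} {+ toℕ j} (+ t) h)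

  -- H_{2p+1,2n}. The definition makes sense for all p and n, but the name is
  -- usual only when p ≥ 1 and n ≥ p + 1.
  Harary : Graph (2 ℕ.* n)
  Harary = record
    { Adj    = λ i j → i ≢ j × (Near i j ⊎ Opposite i j)
    ; adj?   = λ i j → ¬? (i Fin.≟ j) ×-dec
                 (near? i j ⊎-dec ≡mod? (2 ℕ.* n) (i ⊖ j) (+ n))
    ; irrefl = λ i≡j (i≢j , _) → i≢j i≡j
    ; symm   = λ {i} {j} → λ
        { (i≢j , inj₁ h) → (λ e → i≢j (sym e)) , inj₁ (near-sym {i} {j} h)
        ; (i≢j , inj₂ h) → (λ e → i≢j (sym e)) , inj₂ (antipode-mod n {+ toℕ i} {+ toℕ j} h)
        }
    }

2*p-nonZero : ∀ {p} → p > 1 → NonZero (2 ℕ.* p)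
2*p-nonZero {p} p>1 = ℕ.m*n≢0 2 p {{_}} {{>-nonZero (ℕ.<-trans z<s p>1)}}

{-# OPTIONS --safe #-}
module Submission where

open import Defs
open import Algebra.Bundles using (CommutativeRing)
import Algebra.Properties.Semiring.Sum as SemiringSum
open import Data.Bool.Base using (if_then_else_)
open import Data.Fin.Base using (Fin; zero; suc; toℕ; fromℕ<; join; punchIn; punchOut; splitAt; _↑ˡ_; _↑ʳ_)
import Data.Fin.Properties as Fin
open import Data.Integer.Base as ℤ using (+_; -[1+_])
import Data.Integer.Divisibility.Signed as ℤ
import Data.Integer.Properties as ℤ
open import Data.Integer.Tactic.RingSolver using (solve-∀)
open import Data.List.Base using (_∷_; map; allFin; cartesianProduct)
import Data.List.Extrema as Extrema
open import Data.List.Membership.Propositional using (_∈_)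
open import Data.List.Membership.Propositional.Properties
  using (∈-map⁺; ∈-map⁻; ∈-filter⁺; ∈-filter⁻; ∈-cartesianProduct⁺; ∈-allFin)
import Data.List.Relation.Unary.All as All
open import Data.List.Relation.Unary.Any using (here; there)
open import Data.Nat.Base as ℕ using (ℕ; zero; suc; _>_; _≥_; _∸_; z≤n; s≤s; NonZero; >-nonZero)
open import Data.Nat.DivMod
  using (_%_; m%n<n; m%n%n≡m%n; %-distribˡ-+; m<n⇒m%n≡m; [m+n]%n≡m%n; [m+kn]%n≡m%n; m*n%n≡0;
         m≡m%n+[m/n]*n; m/n*n≤m; m*n/n≡m; /-monoˡ-≤)
import Data.Nat.Properties as ℕ
import Data.Nat.Solver as ℕ
open import Data.Product.Base using (∃; ∃₂; _×_; _,_; proj₁; proj₂)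
open import Data.Rational.Base as ℚ using (ℚ; 0ℚ; 1ℚ; ½; _+_; _-_; _*_; _/_; -_; _≤_)
import Data.Rational.Properties as ℚ
open import Data.Rational.Solver using (module +-*-Solver)
import Data.Rational.Unnormalised.Base as ℚᵘ
import Data.Rational.Unnormalised.Properties as ℚᵘ
open import Data.Sum.Base using (_⊎_; inj₁; inj₂; [_,_]′)
open import Function.Base using (_∘_)
open import Relation.Binary.Bundles using (DecTotalOrder)
open import Relation.Binary.PropositionalEquality
open import Relation.Nullary using (¬_; Dec; yes; no; does; contradiction)
open import Relation.Nullary.Decidable using (_×-dec_; _⊎-dec_)

open SemiringSum (CommutativeRing.semiring ℚ.+-*-commutativeRing)
  using (sum; sum-cong-≗; sum-remove; ∑-distrib-+; ∑-comm; *-distribˡ-sum; sum-replicate-zero)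

open Graph

-- A link of H_{2p+1,2n} either runs t ≤ p places along the circle or joins
-- opposite vertices. A shortest walk that crosses the circle may cross first or
-- last, and one that stays on an arc whose length is not a multiple of p may
-- take its one short link first or last; so deleting a link only affects arcs
-- of length exactly m p traversed by m links of length p, and the end points of
-- the deleted link. If the deleted link has length p, every arc of m p places
-- through it with m ≤ k gets distance m + 1 in place of m. There are m such
-- arcs, each counted in both directions, which costs
-- Σ_{m ≤ k} 2 m (2^-m − 2^-(m+1)) = 2 − (k + 2) 2^-k. Deleting any shorter link
-- costs at most ½, and deleting an opposite link costs ¾, as the new distance
-- of its ends is 3; both are at most the above because k ≥ 2.

-- Sums

sum-mono : ∀ {n} {f g : Fin n → ℚ} → (∀ i → f i ≤ g i) → sum f ≤ sum g
sum-mono {zero}  f≤g = ℚ.≤-refl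
sum-mono {suc n} f≤g = ℚ.+-mono-≤ (f≤g zero) (sum-mono (λ i → f≤g (suc i)))

sum-cong : ∀ n {f g : Fin n → ℚ} → (∀ i → f i ≡ g i) → sum f ≡ sum g
sum-cong _ = sum-cong-≗

sum-zero : ∀ {n} {f : Fin n → ℚ} → (∀ i → f i ≡ 0ℚ) → sum f ≡ 0ℚ
sum-zero {n} f≡0 = trans (sum-cong n f≡0) (sum-replicate-zero n)

sum-nonNeg : ∀ {n} {f : Fin n → ℚ} → (∀ i → 0ℚ ≤ f i) → 0ℚ ≤ sum f
sum-nonNeg {n} {f} 0≤f = subst (_≤ sum f) (sum-replicate-zero n) (sum-mono 0≤f)

+-nonNeg : ∀ {x y} → 0ℚ ≤ x → 0ℚ ≤ y → 0ℚ ≤ x + y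
+-nonNeg = ℚ.+-mono-≤

x≤x+y : ∀ x {y} → 0ℚ ≤ y → x ≤ x + y
x≤x+y x {y} 0≤y = subst (_≤ x + y) (ℚ.+-identityʳ x) (ℚ.+-monoʳ-≤ x 0≤y)

term≤sum : ∀ {n} {f : Fin n → ℚ} → (∀ i → 0ℚ ≤ f i) → ∀ i → f i ≤ sum f
term≤sum {suc n} {f} 0≤f i = subst (f i ≤_) (sym (sum-remove f))
  (x≤x+y (f i) (sum-nonNeg (λ j → 0≤f (punchIn i j))))

sum-single : ∀ {n} (f : Fin n → ℚ) a → (∀ i → i ≢ a → f i ≡ 0ℚ) → sum f ≡ f a
sum-single {suc n} f a f≡0 = trans (sum-remove f)
  (trans (cong (_+_ (f a)) (sum-zero λ j → f≡0 _ (Fin.punchInᵢ≢i a j))) (ℚ.+-identityʳ (f a)))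

-- Induction on the domain: `g zero` is removed from the codomain, and `punchOut` squeezes the rest
-- of `g` into what remains.
sum-injective : ∀ {m n} {f : Fin n → ℚ} → (∀ i → 0ℚ ≤ f i) → (g : Fin m → Fin n) →
                (∀ {x y} → g x ≡ g y → x ≡ y) → sum (f ∘ g) ≤ sum f
sum-injective {zero} 0≤f g g-inj = sum-nonNeg 0≤f
sum-injective {suc m} {zero} 0≤f g g-inj with () ← g zero
sum-injective {suc m} {suc n} {f} 0≤f g g-inj = subst₂ _≤_
  (cong (_+_ (f (g zero))) (sum-cong _ λ x → cong f (Fin.punchIn-punchOut (apart x))))
  (sym (sum-remove f))
  (ℚ.+-monoʳ-≤ (f (g zero)) (sum-injective (λ i → 0≤f (punchIn (g zero) i))
    (λ x → punchOut (apart x))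
    λ eq → Fin.suc-injective (g-inj (Fin.punchOut-injective (apart _) (apart _) eq))))
  where
  apart : ∀ x → g zero ≢ g (suc x)
  apart x eq with () ← g-inj eq

sum-split : ∀ m {n} (f : Fin (m ℕ.+ n) → ℚ) →
            sum f ≡ sum (λ x → f (x ↑ˡ n)) + sum (λ y → f (m ↑ʳ y))
sum-split zero    f = sym (ℚ.+-identityˡ _)
sum-split (suc m) f = trans (cong (_+_ (f zero)) (sum-split m (f ∘ suc))) (sym (ℚ.+-assoc (f zero) _ _))

-- Two injections with disjoint images glue to a single injection on `Fin (l + m)`.
sum-injective₂ : ∀ {l m n} {f : Fin n → ℚ} → (∀ i → 0ℚ ≤ f i) →
                 (a : Fin l → Fin n) (b : Fin m → Fin n) →
                 (∀ {x y} → a x ≡ a y → x ≡ y) → (∀ {x y} → b x ≡ b y → x ≡ y) →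
                 (∀ {x y} → a x ≢ b y) → sum (f ∘ a) + sum (f ∘ b) ≤ sum f
sum-injective₂ {l} {m} {f = f} 0≤f a b a-inj b-inj a≢b = subst (_≤ sum f)
  (trans (sum-split l (f ∘ g))
    (cong₂ _+_ (sum-cong _ λ x → cong (f ∘ [ a , b ]′) (Fin.splitAt-↑ˡ l x m))
               (sum-cong _ λ y → cong (f ∘ [ a , b ]′) (Fin.splitAt-↑ʳ l m y))))
  (sum-injective 0≤f g g-inj)
  where
  g : Fin (l ℕ.+ m) → Fin _
  g = [ a , b ]′ ∘ splitAt l

  [a,b]-inj : ∀ u v → [ a , b ]′ u ≡ [ a , b ]′ v → u ≡ v
  [a,b]-inj (inj₁ x) (inj₁ y) eq = cong inj₁ (a-inj eq)
  [a,b]-inj (inj₁ x) (inj₂ y) eq = contradiction eq a≢b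
  [a,b]-inj (inj₂ x) (inj₁ y) eq = contradiction (sym eq) a≢b
  [a,b]-inj (inj₂ x) (inj₂ y) eq = cong inj₂ (b-inj eq)

  g-inj : ∀ {x y} → g x ≡ g y → x ≡ y
  g-inj {x} {y} eq = trans (sym (Fin.join-splitAt l m x))
    (trans (cong (join l m) ([a,b]-inj (splitAt l x) (splitAt l y) eq))
           (Fin.join-splitAt l m y))

-- The region x + y < K. Later x and y count the links of length p before and after the deleted one,
-- so the arcs of m links correspond to the m pairs with x + y + 1 = m.
triangle : ℕ → (ℕ → ℕ → ℚ) → ℚ
triangle K f = sum {K} λ x → sum {K ∸ toℕ x} λ y → f (toℕ x) (toℕ y)

inside : ∀ {K} (x : Fin K) (y : Fin (K ∸ toℕ x)) → toℕ x ℕ.+ toℕ y ℕ.< K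
inside {K} x y = subst (toℕ x ℕ.+ toℕ y ℕ.<_) (ℕ.m+[n∸m]≡n (ℕ.<⇒≤ (Fin.toℕ<n x)))
  (ℕ.+-monoʳ-< (toℕ x) (Fin.toℕ<n y))

triangle-cong : ∀ K {f g : ℕ → ℕ → ℚ} → (∀ x y → f x y ≡ g x y) → triangle K f ≡ triangle K g
triangle-cong K f≡g = sum-cong K λ x → sum-cong (K ∸ toℕ x) λ y → f≡g (toℕ x) (toℕ y)

triangle-+ : ∀ K f g → triangle K (λ x y → f x y + g x y) ≡ triangle K f + triangle K g
triangle-+ K f g = trans
  (sum-cong K λ x → ∑-distrib-+ (λ (y : Fin (K ∸ toℕ x)) → f (toℕ x) (toℕ y)) (λ y → g (toℕ x) (toℕ y)))
  (∑-distrib-+ (λ (x : Fin K) → sum {K ∸ toℕ x} λ y → f (toℕ x) (toℕ y)) _)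

≤triangle : ∀ {K f} → (∀ x y → 0ℚ ≤ f x y) → ∀ {x y} → x ℕ.+ y ℕ.< K → f x y ≤ triangle K f
≤triangle {K} {f} 0≤f {x} {y} x+y<K = ℚ.≤-trans
  (ℚ.≤-reflexive (cong₂ f (sym (Fin.toℕ-fromℕ< x<K)) (sym (Fin.toℕ-fromℕ< y<K-x))))
  (ℚ.≤-trans (term≤sum (λ y → 0≤f _ (toℕ y)) (fromℕ< y<K-x))
    (term≤sum {f = λ (x : Fin K) → sum {K ∸ toℕ x} λ y → f (toℕ x) (toℕ y)}
      (λ x → sum-nonNeg (λ (y : Fin (K ∸ toℕ x)) → 0≤f (toℕ x) (toℕ y))) (fromℕ< x<K)))
  where
  x<K : x ℕ.< K
  x<K = ℕ.≤-<-trans (ℕ.m≤m+n x y) x+y<K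
  y<K-x : y ℕ.< K ∸ toℕ (fromℕ< x<K)
  y<K-x = subst (λ z → y ℕ.< K ∸ z) (sym (Fin.toℕ-fromℕ< x<K))
    (ℕ.m+n≤o⇒m≤o∸n (suc y) (subst (ℕ._< K) (ℕ.+-comm x y) x+y<K))

∑∑-triangle : ∀ {m n} K (f : Fin m → Fin n → ℕ → ℕ → ℚ) →
              sum (λ i → sum λ j → triangle K (f i j)) ≡
              triangle K (λ x y → sum λ i → sum λ j → f i j x y)
∑∑-triangle K f = trans (sum-cong _ λ i → ∑-triangle (f i)) (∑-triangle (λ i x y → sum λ j → f i j x y))
  where
  ∑-triangle : ∀ {n} (g : Fin n → ℕ → ℕ → ℚ) →
               sum (λ j → triangle K (g j)) ≡ triangle K (λ x y → sum λ j → g j x y)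
  ∑-triangle g = trans
    (∑-comm (λ j (x : Fin K) → sum {K ∸ toℕ x} λ y → g j (toℕ x) (toℕ y)))
    (sum-cong K λ x → ∑-comm (λ j (y : Fin (K ∸ toℕ x)) → g j (toℕ x) (toℕ y)))

-- Powers of one half and the value of the triangular sum

half+half : ∀ q → ½ * q + ½ * q ≡ q
half+half q = trans (sym (ℚ.*-distribʳ-+ q ½ ½)) (ℚ.*-identityˡ q)

2^-nonNeg : ∀ d → 0ℚ ≤ 2^- d
2^-nonNeg zero    = ℚ.nonNegative⁻¹ 1ℚ
2^-nonNeg (suc d) = subst (_≤ 2^- suc d) (ℚ.*-zeroʳ ½) (ℚ.*-monoˡ-≤-nonNeg ½ (2^-nonNeg d))

2^-suc-≤ : ∀ d → 2^- suc d ≤ 2^- d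
2^-suc-≤ d = subst (2^- suc d ≤_) (half+half (2^- d)) (x≤x+y (2^- suc d) (2^-nonNeg (suc d)))

2^-antitone : ∀ {d e} → d ℕ.≤ e → 2^- e ≤ 2^- d
2^-antitone {e = zero}  z≤n = ℚ.≤-refl
2^-antitone {e = suc e} z≤n = ℚ.≤-trans (2^-suc-≤ e) (2^-antitone {0} {e} z≤n)
2^-antitone (s≤s d≤e) = ℚ.*-monoˡ-≤-nonNeg ½ (2^-antitone d≤e)

geometric : ∀ K → sum {K} (λ y → 2^- suc (toℕ y)) + 2^- K ≡ 1ℚ
geometric zero    = refl
geometric (suc K) = begin
  ½ + sum {K} (λ y → ½ * 2^- suc (toℕ y)) + ½ * 2^- K
    ≡⟨ cong (λ z → ½ + z + ½ * 2^- K) (*-distribˡ-sum {K} ½ (λ y → 2^- suc (toℕ y))) ⟨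
  ½ + ½ * s + ½ * 2^- K   ≡⟨ ℚ.+-assoc ½ (½ * s) (½ * 2^- K) ⟩
  ½ + (½ * s + ½ * 2^- K) ≡⟨ cong (_+_ ½) (ℚ.*-distribˡ-+ ½ s (2^- K)) ⟨
  ½ + ½ * (s + 2^- K)     ≡⟨ cong (λ z → ½ + ½ * z) (geometric K) ⟩
  1ℚ ∎
  where
  open ≡-Reasoning
  s = sum {K} (λ y → 2^- suc (toℕ y))

suc/1 : ∀ k → + suc k / 1 ≡ 1ℚ + + k / 1
suc/1 k = ℚ.toℚᵘ-injective (begin
  ℚ.toℚᵘ (+ suc k / 1)              ≈⟨ ℚ.toℚᵘ-fromℚᵘ (ℚᵘ.mkℚᵘ (+ suc k) 0) ⟩
  ℚᵘ.mkℚᵘ (+ suc k) 0               ≈⟨ ℚᵘ.*≡* (cong (λ z → (+ 1 ℤ.+ z) ℤ.* + 1) (sym (ℤ.*-identityʳ (+ k)))) ⟩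
  ℚᵘ.1ℚᵘ ℚᵘ.+ ℚᵘ.mkℚᵘ (+ k) 0       ≈⟨ ℚᵘ.+-congʳ ℚᵘ.1ℚᵘ (ℚ.toℚᵘ-fromℚᵘ (ℚᵘ.mkℚᵘ (+ k) 0)) ⟨
  ℚᵘ.1ℚᵘ ℚᵘ.+ ℚ.toℚᵘ (+ k / 1)      ≈⟨ ℚ.toℚᵘ-homo-+ 1ℚ (+ k / 1) ⟨
  ℚ.toℚᵘ (1ℚ + + k / 1)             ∎)
  where open ℚᵘ.≃-Reasoning

-- Induction by rows: the row x = 0 is a geometric sum, and the other rows form half of the next
-- smaller triangle.
triangle-2^- : ∀ K → triangle K (λ x y → 2^- suc (x ℕ.+ y)) + (+ (K ℕ.+ 2) / 1) * 2^- K ≡ + 2 / 1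
triangle-2^- zero    = refl
triangle-2^- (suc K) = begin
  (g + triangle K (λ x y → ½ * f x y)) + (+ suc (K ℕ.+ 2) / 1) * (½ * q)
    ≡⟨ cong₂ (λ t c → (g + t) + c * (½ * q)) ½*triangle (suc/1 (K ℕ.+ 2)) ⟩
  (g + ½ * T) + (1ℚ + c) * (½ * q)
    -- Of the K + 3 copies of 2^-(K+1), one completes the geometric row and K + 2 go to the
    -- induction hypothesis.
    ≡⟨ solve 5 (λ g T c q h → (g :+ h :* T) :+ (con 1ℚ :+ c) :* (h :* q) :=
                             (g :+ h :* q) :+ h :* (T :+ c :* q)) refl g T c q ½ ⟩
  (g + ½ * q) + ½ * (T + c * q)
    ≡⟨ cong₂ (λ a b → a + ½ * b) (geometric (suc K)) (triangle-2^- K) ⟩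
  + 2 / 1 ∎
  where
  open ≡-Reasoning
  open +-*-Solver
  f : ℕ → ℕ → ℚ
  f x y = 2^- suc (x ℕ.+ y)
  g = sum {suc K} (λ y → 2^- suc (toℕ y))
  T = triangle K f
  c = + (K ℕ.+ 2) / 1
  q = 2^- K
  ½*triangle : triangle K (λ x y → ½ * f x y) ≡ ½ * T
  ½*triangle = sym (trans (*-distribˡ-sum {K} ½ (λ x → sum {K ∸ toℕ x} λ y → f (toℕ x) (toℕ y)))
    (sum-cong K λ x → *-distribˡ-sum {K ∸ toℕ x} ½ (λ y → f (toℕ x) (toℕ y))))

-- Walks and weights

-- Together with `walk⇒≤weight` this replaces distances by walks: an upper bound on a weight
-- concerns every walk, a lower bound needs only one.
weight-elim : ∀ {N} (G : Graph N) {i j q} → 0ℚ ≤ q → (∀ {d} → Walk G d i j → 2^- d ≤ q) →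
              weight G i j ≤ q
weight-elim G {i} {j} 0≤q bound with distance? G i j
... | inj₁ (d , w , _) = bound w
... | inj₂ _           = 0≤q

walk⇒≤weight : ∀ {N} (G : Graph N) {i j m} → Walk G m i j → 2^- m ≤ weight G i j
walk⇒≤weight G {i} {j} {m} w with distance? G i j
... | inj₁ (d , _ , least) = 2^-antitone (least w)
... | inj₂ ∄w              = contradiction w (∄w m)

weight-nonNeg : ∀ {N} (G : Graph N) i j → 0ℚ ≤ weight G i j
weight-nonNeg G i j with distance? G i j
... | inj₁ (d , _) = 2^-nonNeg d
... | inj₂ _       = ℚ.≤-refl

map-walk : ∀ {N} {G H : Graph N} → (∀ {i j} → Adj G i j → Adj H i j) →
           ∀ {d i j} → Walk G d i j → Walk H d i j
map-walk f []      = []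
map-walk f (e ∷ w) = f e ∷ map-walk f w

_∷ʳʷ_ : ∀ {N} {G : Graph N} {d i j k} → Walk G d i j → Adj G j k → Walk G (suc d) i k
[]      ∷ʳʷ e = e ∷ []
(f ∷ w) ∷ʳʷ e = f ∷ (w ∷ʳʷ e)

reverse : ∀ {N} {G : Graph N} {d i j} → Walk G d i j → Walk G d j i
reverse         []      = []
reverse {G = G} (e ∷ w) = reverse w ∷ʳʷ symm G e

contribution : ∀ {N} → Graph N → Fin N → Fin N → ℚ
contribution G i j = if does (i Fin.≟ j) then 0ℚ else weight G i j

pick : ∀ {N} → Fin N → Fin N → ℚ → Fin N → Fin N → ℚ
pick a b q i j = if does (i Fin.≟ a) then (if does (j Fin.≟ b) then q else 0ℚ) else 0ℚ

pick-hit : ∀ {N} (a b : Fin N) q → pick a b q a b ≡ q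
pick-hit a b q with a Fin.≟ a | b Fin.≟ b
... | yes _ | yes _ = refl
... | yes _ | no ¬p = contradiction refl ¬p
... | no ¬p | _     = contradiction refl ¬p

pick-missˡ : ∀ {N} {a i : Fin N} b q j → i ≢ a → pick a b q i j ≡ 0ℚ
pick-missˡ {a = a} {i} b q j i≢a with i Fin.≟ a
... | yes i≡a = contradiction i≡a i≢a
... | no  _   = refl

pick-missʳ : ∀ {N} {b j : Fin N} a q i → j ≢ b → pick a b q i j ≡ 0ℚ
pick-missʳ {b = b} {j} a q i j≢b with i Fin.≟ a | j Fin.≟ b
... | yes _ | yes j≡b = contradiction j≡b j≢b
... | yes _ | no _    = refl
... | no _  | _       = refl

pick-nonNeg : ∀ {N} (a b : Fin N) {q} i j → 0ℚ ≤ q → 0ℚ ≤ pick a b q i j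
pick-nonNeg a b i j 0≤q with i Fin.≟ a | j Fin.≟ b
... | yes _ | yes _ = 0≤q
... | yes _ | no _  = ℚ.≤-refl
... | no _  | _     = ℚ.≤-refl

∑∑-pick : ∀ {N} (a b : Fin N) q → sum (λ i → sum λ j → pick a b q i j) ≡ q
∑∑-pick {N} a b q = begin
  sum (λ i → sum λ j → pick a b q i j)
    ≡⟨ sum-single (λ i → sum λ j → pick a b q i j) a (λ i i≢a → sum-zero {N} λ j → pick-missˡ b q j i≢a) ⟩
  sum (λ j → pick a b q a j)  ≡⟨ sum-single (pick a b q a) b (λ j → pick-missʳ a q a) ⟩
  pick a b q a b              ≡⟨ pick-hit a b q ⟩
  q                           ∎
  where open ≡-Reasoning

-- Closeness of two graphs that differ at listed pairs

module _ {N} (K : ℕ) (a b : ℕ → Fin N) where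

  Listed : ℕ → ℕ → Fin N → Fin N → Set
  Listed x y i j = x ℕ.+ y ℕ.< K × ((i ≡ a x × j ≡ b y) ⊎ (i ≡ b y × j ≡ a x))

  -- The second alternative allows a longer walk at a listed pair, at a cost of at most `h x y`. It
  -- compares weights, so the new distance need not be known exactly.
  Detour : Graph N → (ℕ → ℕ → ℚ) → ℕ → Fin N → Fin N → Set
  Detour H h d i j =
    (∃ λ e → e ℕ.≤ d × Walk H e i j) ⊎
    (∃₂ λ x y → Listed x y i j × ∃ λ e → Walk H e i j × 2^- d ≤ 2^- e + h x y)

  Detour-sym : ∀ {H h d i j} → Detour H h d i j → Detour H h d j i
  Detour-sym (inj₁ (e , e≤d , w)) = inj₁ (e , e≤d , reverse w)
  Detour-sym (inj₂ (x , y , (x+y<K , inj₁ (p , q)) , e , w , le)) =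
    inj₂ (x , y , (x+y<K , inj₂ (q , p)) , e , reverse w , le)
  Detour-sym (inj₂ (x , y , (x+y<K , inj₂ (p , q)) , e , w , le)) =
    inj₂ (x , y , (x+y<K , inj₁ (q , p)) , e , reverse w , le)

  -- Entry by entry the loss is at most `Λ`, which adds up the penalties of the listed pairs in both
  -- orders. Coinciding pairs would only be counted more than once, which an upper bound tolerates.
  C-loss : ∀ G H (h : ℕ → ℕ → ℚ) → (∀ x y → 0ℚ ≤ h x y) →
           (∀ {d i j} → i ≢ j → Walk G d i j → Detour H h d i j) →
           C G ≤ C H + triangle K (λ x y → h x y + h x y)
  C-loss G H h 0≤h detour = begin
    sum (λ i → sum λ j → contribution G i j)
      ≤⟨ sum-mono {N} (λ i → sum-mono {N} (λ j → pointwise i j)) ⟩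
    sum (λ i → sum λ j → contribution H i j + Λ i j)
      ≡⟨ sum-cong N (λ i → ∑-distrib-+ (contribution H i) (Λ i)) ⟩
    sum (λ i → sum (contribution H i) + sum (Λ i))
      ≡⟨ ∑-distrib-+ (λ i → sum (contribution H i)) (λ i → sum (Λ i)) ⟩
    C H + sum (λ i → sum (Λ i))
      ≡⟨ cong (_+_ (C H)) (∑∑-triangle K loss) ⟩
    C H + triangle K (λ x y → sum λ i → sum λ j → loss i j x y)
      ≡⟨ cong (_+_ (C H)) (triangle-cong K ∑∑-loss) ⟩
    C H + triangle K (λ x y → h x y + h x y) ∎
    where
    open ℚ.≤-Reasoning
    loss : Fin N → Fin N → ℕ → ℕ → ℚ
    loss i j x y = pick (a x) (b y) (h x y) i j + pick (b y) (a x) (h x y) i j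
    Λ : Fin N → Fin N → ℚ
    Λ i j = triangle K (loss i j)

    loss-nonNeg : ∀ i j x y → 0ℚ ≤ loss i j x y
    loss-nonNeg i j x y = +-nonNeg (pick-nonNeg (a x) (b y) i j (0≤h x y))
                                   (pick-nonNeg (b y) (a x) i j (0≤h x y))

    Λ-nonNeg : ∀ i j → 0ℚ ≤ Λ i j
    Λ-nonNeg i j = sum-nonNeg {K} λ x → sum-nonNeg {K ∸ toℕ x} λ y → loss-nonNeg i j (toℕ x) (toℕ y)

    listed⇒h≤loss : ∀ {x y i j} → Listed x y i j → h x y ≤ loss i j x y
    listed⇒h≤loss {x} {y} (_ , inj₁ (refl , refl)) = subst (_≤ loss (a x) (b y) x y)
      (pick-hit (a x) (b y) (h x y)) (x≤x+y _ (pick-nonNeg (b y) (a x) (a x) (b y) (0≤h x y)))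
    listed⇒h≤loss {x} {y} (_ , inj₂ (refl , refl)) = subst (_≤ loss (b y) (a x) x y)
      (pick-hit (b y) (a x) (h x y))
      (subst (pick (b y) (a x) (h x y) (b y) (a x) ≤_) (ℚ.+-comm (pick (b y) (a x) (h x y) (b y) (a x)) _)
        (x≤x+y _ (pick-nonNeg (a x) (b y) (b y) (a x) (0≤h x y))))

    pointwise : ∀ i j → contribution G i j ≤ contribution H i j + Λ i j
    pointwise i j with i Fin.≟ j
    ... | yes _  = subst (0ℚ ≤_) (sym (ℚ.+-identityˡ (Λ i j))) (Λ-nonNeg i j)
    ... | no i≢j = weight-elim G (+-nonNeg (weight-nonNeg H i j) (Λ-nonNeg i j)) λ w → bound (detour i≢j w)
      where
      bound : ∀ {d} → Detour H h d i j → 2^- d ≤ weight H i j + Λ i j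
      bound (inj₁ (e , e≤d , w)) = ℚ.≤-trans (2^-antitone e≤d)
        (ℚ.≤-trans (walk⇒≤weight H w) (x≤x+y (weight H i j) (Λ-nonNeg i j)))
      bound (inj₂ (x , y , l , e , w , le)) = ℚ.≤-trans le (ℚ.+-mono-≤ (walk⇒≤weight H w)
        (ℚ.≤-trans (listed⇒h≤loss l) (≤triangle (loss-nonNeg i j) (proj₁ l))))

    ∑∑-loss : ∀ x y → sum (λ i → sum λ j → loss i j x y) ≡ h x y + h x y
    ∑∑-loss x y = trans
      (sum-cong N λ i → ∑-distrib-+ (pick (a x) (b y) (h x y) i) (pick (b y) (a x) (h x y) i))
      (trans (∑-distrib-+ (λ i → sum (pick (a x) (b y) (h x y) i)) (λ i → sum (pick (b y) (a x) (h x y) i)))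
        (cong₂ _+_ (∑∑-pick (a x) (b y) (h x y)) (∑∑-pick (b y) (a x) (h x y))))

  -- The rows `a x` and `b y` are all distinct, and so are the columns used within each row. No
  -- entry of the difference matrix `D` is thus counted twice, and the remaining entries are
  -- nonnegative.
  C-gain : ∀ G H (h : ℕ → ℕ → ℚ) → (∀ x y → h x y ≡ h y x) →
           (∀ {x y} → x ℕ.< K → y ℕ.< K → a x ≡ a y → x ≡ y) →
           (∀ {x y} → x ℕ.< K → y ℕ.< K → b x ≡ b y → x ≡ y) →
           (∀ {x y} → x ℕ.< K → y ℕ.< K → a x ≢ b y) →
           (∀ i j → weight H i j ≤ weight G i j) →
           (∀ {x y i j} → Listed x y i j → weight H i j + h x y ≤ weight G i j) →
           C H + triangle K (λ x y → h x y + h x y) ≤ C G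
  C-gain G H h h-sym a-inj b-inj a≢b H≤G gap = begin
    C H + triangle K (λ x y → h x y + h x y)
      ≡⟨ cong (_+_ (C H)) (triangle-+ K h h) ⟩
    C H + (triangle K h + triangle K h)
      ≤⟨ ℚ.+-monoʳ-≤ (C H) (ℚ.+-mono-≤ (sum-mono {K} a-row) (sum-mono {K} b-row)) ⟩
    C H + (sum {K} (λ x → sum (D (a (toℕ x)))) + sum {K} (λ y → sum (D (b (toℕ y)))))
      ≤⟨ ℚ.+-monoʳ-≤ (C H) (sum-injective₂ {K} {K} (λ i → sum-nonNeg (D-nonNeg i))
           (λ x → a (toℕ x)) (λ y → b (toℕ y))
           (λ {x} {y} eq → Fin.toℕ-injective (a-inj (Fin.toℕ<n x) (Fin.toℕ<n y) eq))
           (λ {x} {y} eq → Fin.toℕ-injective (b-inj (Fin.toℕ<n x) (Fin.toℕ<n y) eq))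
           (λ {x} {y} → a≢b (Fin.toℕ<n x) (Fin.toℕ<n y))) ⟩
    C H + sum (λ i → sum (D i))
      ≡⟨ ∑-distrib-+ (λ i → sum (contribution H i)) (λ i → sum (D i)) ⟨
    sum (λ i → sum (contribution H i) + sum (D i))
      ≡⟨ sum-cong N (λ i → ∑-distrib-+ (contribution H i) (D i)) ⟨
    sum (λ i → sum λ j → contribution H i j + D i j)
      ≡⟨ sum-cong N (λ i → sum-cong N λ j → x+[y-x]≡y (contribution H i j) (contribution G i j)) ⟩
    C G ∎
    where
    open ℚ.≤-Reasoning

    x+[y-x]≡y : ∀ x y → x + (y - x) ≡ y
    x+[y-x]≡y = solve 2 (λ x y → x :+ (y :- x) := y) refl
      where open +-*-Solver

    x+y≤z⇒y≤z-x : ∀ {x y z} → x + y ≤ z → y ≤ z - x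
    x+y≤z⇒y≤z-x {x} {y} {z} le = subst (_≤ z - x)
      (solve 2 (λ x y → (x :+ y) :- x := y) refl x y) (ℚ.+-monoˡ-≤ (- x) le)
      where open +-*-Solver

    D : Fin N → Fin N → ℚ
    D i j = contribution G i j - contribution H i j

    D-nonNeg : ∀ i j → 0ℚ ≤ D i j
    D-nonNeg i j with i Fin.≟ j
    ... | yes _ = ℚ.≤-refl
    ... | no  _ = x+y≤z⇒y≤z-x (subst (_≤ weight G i j) (sym (ℚ.+-identityʳ (weight H i j))) (H≤G i j))

    listed⇒h≤D : ∀ {x y i j} → Listed x y i j → i ≢ j → h x y ≤ D i j
    listed⇒h≤D {x} {y} {i} {j} l i≢j with i Fin.≟ j
    ... | yes i≡j = contradiction i≡j i≢j
    ... | no  _   = x+y≤z⇒y≤z-x (gap l)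

    a-row : ∀ (x : Fin K) → sum {K ∸ toℕ x} (λ y → h (toℕ x) (toℕ y)) ≤ sum (D (a (toℕ x)))
    a-row x = ℚ.≤-trans
      (sum-mono {K ∸ toℕ x} λ y → listed⇒h≤D (inside x y , inj₁ (refl , refl)) (a≢b (Fin.toℕ<n x) (bound y)))
      (sum-injective {K ∸ toℕ x} (D-nonNeg (a (toℕ x))) (λ y → b (toℕ y))
        (λ {y} {z} eq → Fin.toℕ-injective (b-inj (bound y) (bound z) eq)))
      where
      bound : ∀ (y : Fin (K ∸ toℕ x)) → toℕ y ℕ.< K
      bound y = ℕ.<-≤-trans (Fin.toℕ<n y) (ℕ.m∸n≤m K (toℕ x))

    b-row : ∀ (y : Fin K) → sum {K ∸ toℕ y} (λ x → h (toℕ y) (toℕ x)) ≤ sum (D (b (toℕ y)))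
    b-row y = ℚ.≤-trans
      (sum-mono {K ∸ toℕ y} λ x → subst (_≤ D (b (toℕ y)) (a (toℕ x))) (h-sym (toℕ x) (toℕ y))
        (listed⇒h≤D (subst (ℕ._< K) (ℕ.+-comm (toℕ y) (toℕ x)) (inside y x) , inj₂ (refl , refl))
          (λ eq → a≢b (bound x) (Fin.toℕ<n y) (sym eq))))
      (sum-injective {K ∸ toℕ y} (D-nonNeg (b (toℕ y))) (λ x → a (toℕ x))
        (λ {x} {z} eq → Fin.toℕ-injective (a-inj (bound x) (bound z) eq)))
      where
      bound : ∀ (x : Fin (K ∸ toℕ y)) → toℕ x ℕ.< K
      bound x = ℕ.<-≤-trans (Fin.toℕ<n x) (ℕ.m∸n≤m K (toℕ y))

-- The Harary graph as a rotation-invariant graph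

module Rotation (N : ℕ) .{{_ : NonZero N}} where

  -- Abstract, so that a and i can be inferred from σ a i.
  abstract
    σ : ℕ → Fin N → Fin N
    σ a i = fromℕ< (m%n<n (toℕ i ℕ.+ a) N)

    toℕ-σ : ∀ a i → toℕ (σ a i) ≡ (toℕ i ℕ.+ a) % N
    toℕ-σ a i = Fin.toℕ-fromℕ< (m%n<n (toℕ i ℕ.+ a) N)

  toℕ-% : ∀ i → toℕ i % N ≡ toℕ i
  toℕ-% i = m<n⇒m%n≡m (Fin.toℕ<n i)

  σ-≡ : ∀ a i {j} → (toℕ i ℕ.+ a) % N ≡ toℕ j → σ a i ≡ j
  σ-≡ a i eq = Fin.toℕ-injective (trans (toℕ-σ a i) eq)

  σ-0 : ∀ i → σ 0 i ≡ i
  σ-0 i = σ-≡ 0 i (trans (cong (_% N) (ℕ.+-identityʳ (toℕ i))) (toℕ-% i))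

  σ-N : ∀ i → σ N i ≡ i
  σ-N i = σ-≡ N i (trans ([m+n]%n≡m%n (toℕ i) N) (toℕ-% i))

  σ-σ : ∀ a b i → σ a (σ b i) ≡ σ (b ℕ.+ a) i
  σ-σ a b i = σ-≡ a (σ b i) (begin
    (toℕ (σ b i) ℕ.+ a) % N            ≡⟨ cong (λ z → (z ℕ.+ a) % N) (toℕ-σ b i) ⟩
    (u % N ℕ.+ a) % N                  ≡⟨ %-distribˡ-+ (u % N) a N ⟩
    (u % N % N ℕ.+ a % N) % N          ≡⟨ cong (λ z → (z ℕ.+ a % N) % N) (m%n%n≡m%n u N) ⟩
    (u % N ℕ.+ a % N) % N              ≡⟨ %-distribˡ-+ u a N ⟨
    (u ℕ.+ a) % N                      ≡⟨ cong (_% N) (ℕ.+-assoc (toℕ i) b a) ⟩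
    (toℕ i ℕ.+ (b ℕ.+ a)) % N          ≡⟨ toℕ-σ (b ℕ.+ a) i ⟨
    toℕ (σ (b ℕ.+ a) i)                ∎)
    where
    open ≡-Reasoning
    u = toℕ i ℕ.+ b

  -- A further rotation by `N ∸ toℕ i` turns the two vertices into those numbered a and b.
  σ-free : ∀ {a b i} → a ℕ.< N → b ℕ.< N → σ a i ≡ σ b i → a ≡ b
  σ-free {a} {b} {i} a<N b<N eq = trans (sym (back a<N)) (trans (cong toℕ lifted) (back b<N))
    where
    x = toℕ i
    back : ∀ {c} → c ℕ.< N → toℕ (σ (c ℕ.+ (N ∸ x)) i) ≡ c
    back {c} c<N = begin
      toℕ (σ (c ℕ.+ (N ∸ x)) i)      ≡⟨ toℕ-σ (c ℕ.+ (N ∸ x)) i ⟩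
      (x ℕ.+ (c ℕ.+ (N ∸ x))) % N    ≡⟨ cong (_% N) (ℕ.+-comm x _) ⟩
      (c ℕ.+ (N ∸ x) ℕ.+ x) % N      ≡⟨ cong (_% N) (ℕ.+-assoc c (N ∸ x) x) ⟩
      (c ℕ.+ (N ∸ x ℕ.+ x)) % N      ≡⟨ cong (λ z → (c ℕ.+ z) % N) (ℕ.m∸n+n≡m (ℕ.<⇒≤ (Fin.toℕ<n i))) ⟩
      (c ℕ.+ N) % N                  ≡⟨ [m+n]%n≡m%n c N ⟩
      c % N                          ≡⟨ m<n⇒m%n≡m c<N ⟩
      c                              ∎
      where open ≡-Reasoning
    lifted : σ (a ℕ.+ (N ∸ x)) i ≡ σ (b ℕ.+ (N ∸ x)) i
    lifted = trans (sym (σ-σ (N ∸ x) a i)) (trans (cong (σ (N ∸ x)) eq) (σ-σ (N ∸ x) b i))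

  σ-back : ∀ {a} i → a ℕ.≤ N → σ (N ∸ a) (σ a i) ≡ i
  σ-back {a} i a≤N = trans (σ-σ (N ∸ a) a i) (trans (cong (λ c → σ c i) (ℕ.m+[n∸m]≡n a≤N)) (σ-N i))

  σ-forth : ∀ {a} i → a ℕ.≤ N → σ a (σ (N ∸ a) i) ≡ i
  σ-forth {a} i a≤N = trans (σ-σ a (N ∸ a) i) (trans (cong (λ c → σ c i) (ℕ.m∸n+n≡m a≤N)) (σ-N i))

  σ-difference : ∀ {i j} → toℕ i ℕ.≤ toℕ j → σ (toℕ j ∸ toℕ i) i ≡ j
  σ-difference {i} {j} i≤j = σ-≡ (toℕ j ∸ toℕ i) i (trans (cong (_% N) (ℕ.m+[n∸m]≡n i≤j)) (toℕ-% j))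

  ∣-% : ∀ m → (+ N) ℤ.∣ (+ m ℤ.- + (m % N))
  ∣-% m = ℤ.divides (+ q) (begin
    + m ℤ.- + r                     ≡⟨ cong (λ z → + z ℤ.- + r) (m≡m%n+[m/n]*n m N) ⟩
    (+ r ℤ.+ + (q ℕ.* N)) ℤ.- + r   ≡⟨ cong (λ z → (+ r ℤ.+ z) ℤ.- + r) (ℤ.pos-* q N) ⟩
    (+ r ℤ.+ + q ℤ.* + N) ℤ.- + r   ≡⟨ cancel (+ r) (+ q ℤ.* + N) ⟩
    + q ℤ.* + N                     ∎)
    where
    open ≡-Reasoning
    r = m % N
    q = m ℕ./ N
    cancel : ∀ x y → (x ℤ.+ y) ℤ.- x ≡ y
    cancel = solve-∀

  ∣⇒%≡ : ∀ {m o} → (+ N) ℤ.∣ (+ m ℤ.- + o) → m % N ≡ o % N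
  ∣⇒%≡ {m} {o} (ℤ.divides (+ q) eq) = trans (cong (_% N) (ℤ.+-injective (begin
    + m                          ≡⟨ shift (+ m) (+ o) ⟩
    + o ℤ.+ (+ m ℤ.- + o)        ≡⟨ cong (ℤ._+_ (+ o)) (trans eq (sym (ℤ.pos-* q N))) ⟩
    + (o ℕ.+ q ℕ.* N)            ∎))) ([m+kn]%n≡m%n o q N)
    where
    open ≡-Reasoning
    shift : ∀ x y → x ≡ y ℤ.+ (x ℤ.- y)
    shift = solve-∀
  -- A negative quotient makes o the larger number, so the multiple of N is added to m instead.
  ∣⇒%≡ {m} {o} (ℤ.divides -[1+ q ] eq) = sym (trans (cong (_% N) (ℤ.+-injective (begin
    + o                              ≡⟨ shift (+ m) (+ o) ⟩
    + m ℤ.+ ℤ.- (+ m ℤ.- + o)        ≡⟨ cong (λ z → + m ℤ.+ ℤ.- z) eq ⟩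
    + m ℤ.+ ℤ.- (-[1+ q ] ℤ.* + N)   ≡⟨ cong (ℤ._+_ (+ m)) (ℤ.neg-distribˡ-* -[1+ q ] (+ N)) ⟩
    + m ℤ.+ + suc q ℤ.* + N          ≡⟨ cong (ℤ._+_ (+ m)) (ℤ.pos-* (suc q) N) ⟨
    + (m ℕ.+ suc q ℕ.* N)            ∎))) ([m+kn]%n≡m%n m (suc q) N))
    where
    open ≡-Reasoning
    shift : ∀ x y → y ≡ x ℤ.+ ℤ.- (x ℤ.- y)
    shift = solve-∀

module HararyGraph (p n : ℕ) (p<n : p ℕ.< n) where

  N : ℕ
  N = 2 ℕ.* n

  n<N : n ℕ.< N
  n<N = ℕ.m<m+n n (ℕ.≤-trans (ℕ.≤-<-trans z≤n p<n) (ℕ.m≤m+n n 0))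

  instance
    N≢0 : NonZero N
    N≢0 = >-nonZero (ℕ.≤-<-trans z≤n n<N)

  open Rotation N public
  open Graph

  G : Graph N
  G = Harary p n

  n+n≡N : n ℕ.+ n ≡ N
  n+n≡N = cong (n ℕ.+_) (sym (ℕ.+-identityʳ n))

  σ-n-n : ∀ i → σ n (σ n i) ≡ i
  σ-n-n i = trans (σ-σ n n i) (trans (cong (λ c → σ c i) n+n≡N) (σ-N i))

  σ-moves : ∀ {a i} → 1 ℕ.≤ a → a ℕ.< N → i ≢ σ a i
  σ-moves {i = i} 1≤a a<N eq with () ← subst (1 ℕ.≤_)
    (sym (σ-free (ℕ.≤-<-trans z≤n a<N) a<N (trans (σ-0 i) eq))) 1≤a

  adj-near : ∀ {t i} → 1 ℕ.≤ t → t ℕ.≤ p → Adj G i (σ t i)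
  adj-near {t} {i} 1≤t t≤p =
    σ-moves 1≤t (ℕ.≤-<-trans t≤p (ℕ.<-trans p<n n<N)) , inj₁ (t , (1≤t , t≤p) , inj₂ divisible)
    where
    rearrange : ∀ x y t → (x ℤ.+ t) ℤ.- y ≡ (x ℤ.- y) ℤ.- ℤ.- t
    rearrange = solve-∀
    divisible : (+ N) ℤ.∣ ((+ toℕ i ℤ.- + toℕ (σ t i)) ℤ.- ℤ.- + t)
    divisible = subst ((+ N) ℤ.∣_)
      (trans (cong (λ y → + (toℕ i ℕ.+ t) ℤ.- + y) (sym (toℕ-σ t i))) (rearrange (+ toℕ i) (+ toℕ (σ t i)) (+ t)))
      (∣-% (toℕ i ℕ.+ t))

  adj-opposite : ∀ {i} → Adj G i (σ n i)
  adj-opposite {i} = σ-moves (ℕ.≤-<-trans z≤n p<n) n<N , inj₂ divisible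
    where
    rearrange : ∀ x y t → ((x ℤ.+ t) ℤ.- y) ℤ.- (t ℤ.+ t) ≡ (x ℤ.- y) ℤ.- t
    rearrange = solve-∀
    divisible : (+ N) ℤ.∣ ((+ toℕ i ℤ.- + toℕ (σ n i)) ℤ.- + n)
    divisible = subst ((+ N) ℤ.∣_)
      (trans (cong₂ (λ y z → (+ (toℕ i ℕ.+ n) ℤ.- + y) ℤ.- + z) (sym (toℕ-σ n i)) (sym n+n≡N))
        (rearrange (+ toℕ i) (+ toℕ (σ n i)) (+ n)))
      -- N divides x - y + n, hence also x - y + n - (n + n) = x - y - n.
      (ℤ.∣m∣n⇒∣m-n (∣-% (toℕ i ℕ.+ n)) ℤ.∣-refl)

  -- Adjacency in terms of rotations. A backward link is recorded as a forward rotation of j, which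
  -- avoids negative offsets.
  data Step (i j : Fin N) : Set where
    ahead    : ∀ {t} → 1 ℕ.≤ t → t ℕ.≤ p → j ≡ σ t i → Step i j
    behind   : ∀ {t} → 1 ℕ.≤ t → t ℕ.≤ p → i ≡ σ t j → Step i j
    opposite : j ≡ σ n i → Step i j

  step : ∀ {i j} → Adj G i j → Step i j
  step {i} {j} (_ , inj₁ (t , (1≤t , t≤p) , inj₁ d)) = behind 1≤t t≤p
    (sym (σ-≡ t j (trans (sym (∣⇒%≡ (subst ((+ N) ℤ.∣_) (rearrange (+ toℕ i) (+ toℕ j) (+ t)) d))) (toℕ-% i))))
    where
    rearrange : ∀ x y t → (x ℤ.- y) ℤ.- t ≡ x ℤ.- (y ℤ.+ t)
    rearrange = solve-∀
  step {i} {j} (_ , inj₁ (t , (1≤t , t≤p) , inj₂ d)) = ahead 1≤t t≤p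
    (sym (σ-≡ t i (trans (∣⇒%≡ (subst ((+ N) ℤ.∣_) (rearrange (+ toℕ i) (+ toℕ j) (+ t)) d)) (toℕ-% j))))
    where
    rearrange : ∀ x y t → (x ℤ.- y) ℤ.- ℤ.- t ≡ (x ℤ.+ t) ℤ.- y
    rearrange = solve-∀
  step {i} {j} (_ , inj₂ d) = opposite (trans (sym (σ-n-n j))
    (cong (σ n) (σ-≡ n j (trans (sym (∣⇒%≡ (subst ((+ N) ℤ.∣_) (rearrange (+ toℕ i) (+ toℕ j) (+ n)) d))) (toℕ-% i)))))
    where
    rearrange : ∀ x y t → (x ℤ.- y) ℤ.- t ≡ x ℤ.- (y ℤ.+ t)
    rearrange = solve-∀

  -- If the forward gap exceeds half a turn, the complementary gap from j does not. Later arguments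
  -- can thus be confined to targets `σ a i` with a ≤ n.
  short-gap-ordered : ∀ {i j} → toℕ i ℕ.≤ toℕ j →
                      (∃ λ a → a ℕ.≤ n × j ≡ σ a i) ⊎ (∃ λ a → a ℕ.≤ n × i ≡ σ a j)
  short-gap-ordered {i} {j} i≤j with toℕ j ∸ toℕ i ℕ.≤? n
  ... | yes c≤n = inj₁ (toℕ j ∸ toℕ i , c≤n , sym (σ-difference i≤j))
  ... | no  c≰n = inj₂ (N ∸ c ,
          ℕ.≤-trans (ℕ.∸-monoʳ-≤ N (ℕ.<⇒≤ (ℕ.≰⇒> c≰n))) (ℕ.≤-reflexive (trans (cong (_∸ n) (sym n+n≡N)) (ℕ.m+n∸n≡m n n))) ,
          trans (sym (σ-back i (ℕ.≤-trans (ℕ.m∸n≤m (toℕ j) (toℕ i)) (ℕ.<⇒≤ (Fin.toℕ<n j)))))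
                (cong (σ (N ∸ c)) (σ-difference i≤j)))
    where
    c = toℕ j ∸ toℕ i

  short-gap : ∀ i j → (∃ λ a → a ℕ.≤ n × j ≡ σ a i) ⊎ (∃ λ a → a ℕ.≤ n × i ≡ σ a j)
  short-gap i j with ℕ.≤-total (toℕ i) (toℕ j)
  ... | inj₁ i≤j = short-gap-ordered i≤j
  ... | inj₂ j≤i = [ inj₂ , inj₁ ]′ (short-gap-ordered j≤i)

-- Division by p with remainders from 1 to p

no-remainder : ∀ {p b} l l′ → 1 ℕ.≤ b → b ℕ.< p → l ℕ.* p ≢ b ℕ.+ l′ ℕ.* p
no-remainder {p} {b} l l′ 1≤b b<p eq = contradiction 1≤b (ℕ.<⇒≱ (s≤s (ℕ.≤-reflexive (begin
  b                      ≡⟨ m<n⇒m%n≡m b<p ⟨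
  b % p                  ≡⟨ [m+kn]%n≡m%n b l′ p ⟨
  (b ℕ.+ l′ ℕ.* p) % p   ≡⟨ cong (_% p) eq ⟨
  l ℕ.* p % p            ≡⟨ m*n%n≡0 l p ⟩
  0                      ∎))))
  where
  open ≡-Reasoning
  instance
    p≢0 : NonZero p
    p≢0 = >-nonZero (ℕ.≤-<-trans z≤n b<p)

-- Dividing c - 1 instead of c puts the remainder between 1 and p, so that q + 1 is c / p rounded
-- up: the number of links needed for c places.
split : ∀ p → 1 ℕ.≤ p → ∀ {c} → 1 ℕ.≤ c → ∃₂ λ q b → c ≡ q ℕ.* p ℕ.+ b × 1 ℕ.≤ b × b ℕ.≤ p
split p 1≤p {suc c} _ = c ℕ./ p , suc (c % p) ,
  trans (cong suc (trans (m≡m%n+[m/n]*n c p) (ℕ.+-comm (c % p) _))) (sym (ℕ.+-suc _ (c % p))) ,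
  s≤s z≤n , m%n<n c p
  where
  instance
    p≢0 : NonZero p
    p≢0 = >-nonZero 1≤p

quotient-< : ∀ {p q b c d} → 1 ℕ.≤ b → c ≡ q ℕ.* p ℕ.+ b → c ℕ.≤ d ℕ.* p → q ℕ.< d
quotient-< {p} {q} {d = d} 1≤b refl le = ℕ.*-cancelʳ-< p q d (ℕ.<-≤-trans (ℕ.m<m+n (q ℕ.* p) 1≤b) le)

-- Distances along the circle and across it

module Paths (p n : ℕ) (1<p : 1 ℕ.< p) (3p<n : 3 ℕ.* p ℕ.< n) where

  1≤p : 1 ℕ.≤ p
  1≤p = ℕ.<⇒≤ 1<p

  p<n : p ℕ.< n
  p<n = ℕ.≤-<-trans (ℕ.m≤m+n p (2 ℕ.* p)) 3p<n

  open HararyGraph p n p<n public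

  σ-comm : ∀ a b i → σ a (σ b i) ≡ σ b (σ a i)
  σ-comm a b i = trans (σ-σ a b i) (trans (cong (λ c → σ c i) (ℕ.+-comm b a)) (sym (σ-σ b a i)))

  <n+n⇒<N : ∀ {a} → a ℕ.< n ℕ.+ n → a ℕ.< N
  <n+n⇒<N {a} = subst (a ℕ.<_) n+n≡N

  ≤n⇒<N : ∀ {a} → a ℕ.≤ n → a ℕ.< N
  ≤n⇒<N a≤n = ℕ.≤-<-trans a≤n n<N

  n+<N : ∀ {a} → a ℕ.< n → n ℕ.+ a ℕ.< N
  n+<N a<n = <n+n⇒<N (ℕ.+-monoʳ-< n a<n)

  -- A walk of m links makes a net shift s − u of at most m p, or of at most (m − 1) p
  -- plus half a turn if it crosses an odd number of times; s and u avoid subtraction.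
  data Reach : ℕ → Fin N → Fin N → Set where
    around : ∀ {m i j} s u → s ℕ.+ u ℕ.≤ m ℕ.* p → σ s i ≡ σ u j → Reach m i j
    across : ∀ {m i j} s u → s ℕ.+ u ℕ.≤ m ℕ.* p → σ (n ℕ.+ s) i ≡ σ u j → Reach (suc m) i j

  private
    slideʳ : ∀ {s u t x} → t ℕ.≤ p → s ℕ.+ u ℕ.≤ x → s ℕ.+ (u ℕ.+ t) ℕ.≤ p ℕ.+ x
    slideʳ {s} {u} {t} {x} t≤p le = subst₂ ℕ._≤_ (ℕ.+-assoc s u t) (ℕ.+-comm x p) (ℕ.+-mono-≤ le t≤p)

    slideˡ : ∀ {s u t x} → t ℕ.≤ p → s ℕ.+ u ℕ.≤ x → t ℕ.+ s ℕ.+ u ℕ.≤ p ℕ.+ x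
    slideˡ {s} {u} {t} {x} t≤p le = subst (ℕ._≤ p ℕ.+ x) (sym (ℕ.+-assoc t s u)) (ℕ.+-mono-≤ t≤p le)

    behind-≡ : ∀ {a u t i j k} → i ≡ σ t k → σ a k ≡ σ u j → σ a i ≡ σ (u ℕ.+ t) j
    behind-≡ {a} {u} {t} {j = j} {k} refl eq =
      trans (σ-comm a t k) (trans (cong (σ t) eq) (σ-σ t u j))

  walk⇒reach : ∀ {m i j} → Walk G m i j → Reach m i j
  walk⇒reach {i = i} [] = around 0 0 z≤n refl
  walk⇒reach (e ∷ w) = extend (step e) (walk⇒reach w)
    where
    extend : ∀ {m i k j} → Step i k → Reach m k j → Reach (suc m) i j
    extend {i = i} (ahead {t} _ t≤p refl) (around s u le eq) =
      around (t ℕ.+ s) u (slideˡ {s} t≤p le) (trans (sym (σ-σ s t i)) eq)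
    extend {i = i} (ahead {t} _ t≤p refl) (across s u le eq) =
      across (t ℕ.+ s) u (slideˡ {s} t≤p le) (begin
        σ (n ℕ.+ (t ℕ.+ s)) i   ≡⟨ cong (λ c → σ c i) (solve 3 (λ n t s → n :+ (t :+ s) := t :+ (n :+ s)) refl n t s) ⟩
        σ (t ℕ.+ (n ℕ.+ s)) i   ≡⟨ σ-σ (n ℕ.+ s) t i ⟨
        σ (n ℕ.+ s) (σ t i)     ≡⟨ eq ⟩
        σ u _                   ∎)
      where
      open ≡-Reasoning
      open ℕ.+-*-Solver
    extend (behind {t} _ t≤p i≡) (around s u le eq) =
      around s (u ℕ.+ t) (slideʳ {s} t≤p le) (behind-≡ i≡ eq)
    extend (behind {t} _ t≤p i≡) (across s u le eq) =
      across s (u ℕ.+ t) (slideʳ {s} t≤p le) (behind-≡ i≡ eq)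
    extend {i = i} (opposite refl) (around s u le eq) = across s u le (trans (sym (σ-σ s n i)) eq)
    -- Two crossings add up to a full turn, and their two links only enlarge the allowance for s +
    -- u.
    extend {i = i} (opposite refl) (across {m} s u le eq) =
      around s u (ℕ.≤-trans le (ℕ.*-monoˡ-≤ p (ℕ.m≤n+m m 2)))
        (trans (cong (σ s) (sym (σ-n-n i))) (trans (σ-σ s n (σ n i)) eq))

  -- If the respective bound fails, all offsets stay below a full turn and freeness equates them: s
  -- = a + u although s < a, or n + s = a + u although a + u < n.
  walk-bound : ∀ {m i a} → a ℕ.≤ n → Walk G m i (σ a i) →
               a ℕ.≤ m ℕ.* p ⊎ ∃ λ m′ → m ≡ suc m′ × n ℕ.≤ a ℕ.+ m′ ℕ.* p
  walk-bound {i = i} {a} a≤n w = bound (walk⇒reach w)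
    where
    bound : ∀ {m} → Reach m i (σ a i) → a ℕ.≤ m ℕ.* p ⊎ ∃ λ m′ → m ≡ suc m′ × n ℕ.≤ a ℕ.+ m′ ℕ.* p
    bound {m} (around s u le eq) with a ℕ.≤? m ℕ.* p
    ... | yes a≤mp = inj₁ a≤mp
    ... | no  a≰mp = contradiction
            (ℕ.≤-trans (ℕ.m≤m+n a u) (ℕ.≤-reflexive (sym s≡a+u))) (ℕ.<⇒≱ s<a)
      where
      mp<a : m ℕ.* p ℕ.< a
      mp<a = ℕ.≰⇒> a≰mp
      s<a : s ℕ.< a
      s<a = ℕ.≤-<-trans (ℕ.m+n≤o⇒m≤o s le) mp<a
      u<a : u ℕ.< a
      u<a = ℕ.≤-<-trans (ℕ.m+n≤o⇒n≤o s le) mp<a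
      s≡a+u : s ≡ a ℕ.+ u
      s≡a+u = σ-free (ℕ.<-trans s<a (≤n⇒<N a≤n))
        (<n+n⇒<N (ℕ.+-mono-≤-< a≤n (ℕ.<-≤-trans u<a a≤n))) (trans eq (σ-σ u a i))
    bound (across {m} s u le eq) with n ℕ.≤? a ℕ.+ m ℕ.* p
    ... | yes n≤a+mp = inj₂ (m , refl , n≤a+mp)
    ... | no  n≰a+mp = contradiction
            (ℕ.≤-trans (ℕ.m≤m+n n s) (ℕ.≤-reflexive n+s≡a+u)) (ℕ.<⇒≱ a+u<n)
      where
      a+mp<n : a ℕ.+ m ℕ.* p ℕ.< n
      a+mp<n = ℕ.≰⇒> n≰a+mp
      a+u<n : a ℕ.+ u ℕ.< n
      a+u<n = ℕ.≤-<-trans (ℕ.+-monoʳ-≤ a (ℕ.m+n≤o⇒n≤o s le)) a+mp<n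
      s<n : s ℕ.< n
      s<n = ℕ.≤-<-trans (ℕ.≤-trans (ℕ.m+n≤o⇒m≤o s le) (ℕ.m≤n+m (m ℕ.* p) a)) a+mp<n
      n+s≡a+u : n ℕ.+ s ≡ a ℕ.+ u
      n+s≡a+u = σ-free (n+<N s<n) (ℕ.<-trans a+u<n n<N) (trans eq (σ-σ u a i))

  σ-cong : ∀ {a b} i → a ≡ b → σ a i ≡ σ b i
  σ-cong i = cong (λ c → σ c i)

  straight : (K : Graph N) → (∀ {t i} → 1 ℕ.≤ t → t ℕ.≤ p → Adj K i (σ t i)) →
             ∀ q {b} z → 1 ℕ.≤ b → b ℕ.≤ p → Walk K (suc q) z (σ (q ℕ.* p ℕ.+ b) z)
  straight K near zero    z 1≤b b≤p = near 1≤b b≤p ∷ []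
  straight K near (suc q) {b} z 1≤b b≤p = near 1≤p ℕ.≤-refl ∷
    subst (Walk K (suc q) (σ p z))
      (trans (σ-σ (q ℕ.* p ℕ.+ b) p z) (σ-cong z (sym (ℕ.+-assoc p (q ℕ.* p) b))))
      (straight K near q (σ p z) 1≤b b≤p)

  -- The vertices x p places before u and y p places after w, where N ∸ x p is a true
  -- difference as long as x p ≤ N.
  before after : Fin N → ℕ → Fin N
  before u x = σ (N ∸ x ℕ.* p) u
  after w y = σ (y ℕ.* p) w

  -- Deleting a link of length t ≤ p along the circle

  -- Only a lower bound on H is asked for, so that both orientations of the deleted
  -- link are covered.
  module DeletedNear {t} (1≤t : 1 ℕ.≤ t) (t≤p : t ℕ.≤ p) (u : Fin N) (H : Graph N)
    (keep : ∀ {i j} → Adj G i j → ¬ ((i ≡ u × j ≡ σ t u) ⊎ (i ≡ σ t u × j ≡ u)) → Adj H i j) where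

    w : Fin N
    w = σ t u

    near-kept : ∀ {τ y} → 1 ℕ.≤ τ → τ ℕ.≤ p → ¬ (y ≡ u × τ ≡ t) → Adj H y (σ τ y)
    near-kept {τ} {y} 1≤τ τ≤p other = keep (adj-near 1≤τ τ≤p) λ
      { (inj₁ (refl , eq)) → other (refl , σ-free (≤p⇒<N τ≤p) (≤p⇒<N t≤p) eq)
      -- In the reversed orientation, t + τ places would lead from u back to u, although they are
      -- fewer than a full turn.
      ; (inj₂ (refl , eq)) → σ-moves (ℕ.≤-trans 1≤t (ℕ.m≤m+n t τ))
          (<n+n⇒<N (ℕ.+-mono-≤-< (ℕ.≤-trans t≤p (ℕ.<⇒≤ p<n)) (ℕ.≤-<-trans τ≤p p<n)))
          (trans (sym eq) (σ-σ τ t u)) }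
      where
      ≤p⇒<N : ∀ {a} → a ℕ.≤ p → a ℕ.< N
      ≤p⇒<N a≤p = ≤n⇒<N (ℕ.≤-trans a≤p (ℕ.<⇒≤ p<n))

    opposite-kept : ∀ {y} → Adj H y (σ n y)
    opposite-kept {y} = keep adj-opposite λ
      { (inj₁ (refl , eq)) → ℕ.<⇒≢ t<n (σ-free (ℕ.<-trans t<n n<N) n<N (sym eq))
      ; (inj₂ (refl , eq)) → σ-moves (ℕ.≤-trans 1≤t (ℕ.m≤n+m t n)) (n+<N t<n)
          (trans (sym eq) (trans (σ-σ n t u) (σ-cong u (ℕ.+-comm t n)))) }
      where
      t<n : t ℕ.< n
      t<n = ℕ.≤-<-trans t≤p p<n

    -- Here l counts the full links taken before the deleted one is met, which is either among the q
    -- full links or the final link of length b.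
    straight-or-hit : ∀ q {b} z → 1 ℕ.≤ b → b ℕ.≤ p →
      Walk H (suc q) z (σ (q ℕ.* p ℕ.+ b) z) ⊎
      ∃ λ l → u ≡ σ (l ℕ.* p) z × ((l ℕ.< q × t ≡ p) ⊎ (l ≡ q × t ≡ b))
    straight-or-hit zero {b} z 1≤b b≤p with (z Fin.≟ u) ×-dec (b ℕ.≟ t)
    ... | yes (z≡u , b≡t) = inj₂ (0 , sym (trans (σ-0 z) z≡u) , inj₂ (refl , sym b≡t))
    ... | no  other       = inj₁ (near-kept 1≤b b≤p other ∷ [])
    straight-or-hit (suc q) {b} z 1≤b b≤p with (z Fin.≟ u) ×-dec (p ℕ.≟ t)
    ... | yes (z≡u , p≡t) = inj₂ (0 , sym (trans (σ-0 z) z≡u) , inj₁ (s≤s z≤n , sym p≡t))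
    ... | no  other with straight-or-hit q (σ p z) 1≤b b≤p
    ...   | inj₁ v = inj₁ (near-kept 1≤p ℕ.≤-refl other ∷ subst (Walk H (suc q) (σ p z))
              (trans (σ-σ (q ℕ.* p ℕ.+ b) p z) (σ-cong z (sym (ℕ.+-assoc p (q ℕ.* p) b)))) v)
    ...   | inj₂ (l , u≡ , inj₁ (l<q , t≡p)) = inj₂ (suc l , trans u≡ (σ-σ (l ℕ.* p) p z) , inj₁ (s≤s l<q , t≡p))
    ...   | inj₂ (l , u≡ , inj₂ (l≡q , t≡b)) = inj₂ (suc l , trans u≡ (σ-σ (l ℕ.* p) p z) , inj₂ (cong suc l≡q , t≡b))

    -- With the short link taken first, the later links start at offsets b + l p instead of l p.
    remainder-first-or-hit : ∀ q {b} z → 1 ℕ.≤ b → b ℕ.≤ p → ¬ (z ≡ u × b ≡ t) →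
      Walk H (suc (suc q)) z (σ (suc q ℕ.* p ℕ.+ b) z) ⊎
      ∃ λ l → l ℕ.≤ q × u ≡ σ (b ℕ.+ l ℕ.* p) z × t ≡ p
    remainder-first-or-hit q {b} z 1≤b b≤p other with straight-or-hit q (σ b z) 1≤p ℕ.≤-refl
    ... | inj₁ v = inj₁ (near-kept 1≤b b≤p other ∷ subst (Walk H (suc q) (σ b z))
            (trans (σ-σ (q ℕ.* p ℕ.+ p) b z)
              (σ-cong z (trans (ℕ.+-comm b _) (cong (ℕ._+ b) (ℕ.+-comm (q ℕ.* p) p))))) v)
    ... | inj₂ (l , u≡ , inj₁ (l<q , t≡p)) = inj₂ (l , ℕ.<⇒≤ l<q , trans u≡ (σ-σ (l ℕ.* p) b z) , t≡p)
    ... | inj₂ (l , u≡ , inj₂ (l≡q , t≡p)) =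
            inj₂ (l , ℕ.≤-reflexive l≡q , trans u≡ (σ-σ (l ℕ.* p) b z) , t≡p)

    same-offset : ∀ {x y i} → x ℕ.≤ n → y ℕ.≤ n → u ≡ σ x i → u ≡ σ y i → x ≡ y
    same-offset x≤n y≤n u≡ u≡′ = σ-free (≤n⇒<N x≤n) (≤n⇒<N y≤n) (trans (sym u≡) u≡′)

    -- The pairs whose distance may grow: ends of arcs whose length is a multiple of p, where no
    -- link can be short, and for q = 0 the ends of the deleted link. The detour has one link more
    -- than the q + 1 of the arc.
    Spoilt : ℕ → ℕ → Fin N → Fin N → Set
    Spoilt q b i j = ∃₂ λ x y → x ℕ.+ y ≡ q × (q ≡ 0 ⊎ b ≡ p) × i ≡ before u x × j ≡ after w y ×
                     Walk H (suc (suc q)) i j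

    spoilt-multiple : ∀ {q l i} → t ≡ p → l ℕ.≤ q → q ℕ.* p ℕ.+ p ℕ.≤ n → u ≡ σ (l ℕ.* p) i →
                      Spoilt q p i (σ (q ℕ.* p ℕ.+ p) i)
    spoilt-multiple {q} {l} {i} t≡p l≤q le u≡ =
      l , q ∸ l , ℕ.m+[n∸m]≡n l≤q , inj₂ refl ,
      trans (sym (σ-back i (ℕ.≤-trans (lp≤n l≤q) (ℕ.<⇒≤ n<N)))) (cong (σ (N ∸ l ℕ.* p)) (sym u≡)) ,
      after≡ , detour
      where
      lp≤n : ∀ {l} → l ℕ.≤ q → l ℕ.* p ℕ.≤ n
      lp≤n l≤q = ℕ.≤-trans (ℕ.*-monoˡ-≤ p l≤q) (ℕ.m+n≤o⇒m≤o (q ℕ.* p) le)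

      after≡ : σ (q ℕ.* p ℕ.+ p) i ≡ σ ((q ∸ l) ℕ.* p) w
      after≡ = begin
        σ (q ℕ.* p ℕ.+ p) i                              ≡⟨ σ-cong i offset ⟩
        σ (l ℕ.* p ℕ.+ (p ℕ.+ (q ∸ l) ℕ.* p)) i          ≡⟨ σ-σ (p ℕ.+ (q ∸ l) ℕ.* p) (l ℕ.* p) i ⟨
        σ (p ℕ.+ (q ∸ l) ℕ.* p) (σ (l ℕ.* p) i)          ≡⟨ cong (σ _) u≡ ⟨
        σ (p ℕ.+ (q ∸ l) ℕ.* p) u                        ≡⟨ σ-σ ((q ∸ l) ℕ.* p) p u ⟨
        σ ((q ∸ l) ℕ.* p) (σ p u)                        ≡⟨ cong (λ c → σ ((q ∸ l) ℕ.* p) (σ c u)) t≡p ⟨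
        σ ((q ∸ l) ℕ.* p) w                              ∎
        where
        open ≡-Reasoning
        offset : q ℕ.* p ℕ.+ p ≡ l ℕ.* p ℕ.+ (p ℕ.+ (q ∸ l) ℕ.* p)
        offset = trans (cong (λ c → c ℕ.* p ℕ.+ p) (sym (ℕ.m+[n∸m]≡n l≤q)))
          (solve 3 (λ l d p → (l :+ d) :* p :+ p := l :* p :+ (p :+ d :* p)) refl l (q ∸ l) p)
          where open ℕ.+-*-Solver

      detour : Walk H (suc (suc q)) i (σ (q ℕ.* p ℕ.+ p) i)
      -- A link of length 1, then q full links, then one of length p - 1. After the first link they
      -- start at offsets 1 + l′ p, while u lies at a multiple of p; this is where p > 1 enters.
      detour with straight-or-hit q {p ∸ 1} (σ 1 i) (ℕ.∸-monoˡ-≤ 1 1<p) (ℕ.m∸n≤m p 1)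
      ... | inj₁ v = near-kept ℕ.≤-refl 1≤p (λ (_ , 1≡t) → ℕ.<⇒≢ 1<p (trans 1≡t t≡p)) ∷
              subst (Walk H (suc q) (σ 1 i)) (trans (σ-σ _ 1 i) (σ-cong i (begin
                1 ℕ.+ (q ℕ.* p ℕ.+ (p ∸ 1))   ≡⟨ ℕ.+-suc (q ℕ.* p) (p ∸ 1) ⟨
                q ℕ.* p ℕ.+ suc (p ∸ 1)       ≡⟨ cong (q ℕ.* p ℕ.+_) (ℕ.m+[n∸m]≡n 1≤p) ⟩
                q ℕ.* p ℕ.+ p                 ∎))) v
        where open ≡-Reasoning
      ... | inj₂ (l′ , u≡′ , r) = contradiction
              (same-offset (lp≤n l≤q) (ℕ.≤-trans (ℕ.+-mono-≤ 1≤p (ℕ.*-monoˡ-≤ p l′≤q)) (ℕ.≤-trans (ℕ.≤-reflexive (ℕ.+-comm p _)) le))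
                u≡ (trans u≡′ (σ-σ (l′ ℕ.* p) 1 i)))
              (no-remainder l l′ ℕ.≤-refl 1<p)
        where
        l′≤q : l′ ℕ.≤ q
        l′≤q = [ ℕ.<⇒≤ ∘ proj₁ , ℕ.≤-reflexive ∘ proj₁ ]′ r

    -- If the order with the short link last meets the deleted link and b < p, the short link is
    -- taken first. Only multiples of p and the deleted link itself defeat both orders.
    forward : ∀ q {b} i → 1 ℕ.≤ b → b ℕ.≤ p → q ℕ.* p ℕ.+ b ℕ.≤ n →
              Walk H (suc q) i (σ (q ℕ.* p ℕ.+ b) i) ⊎ Spoilt q b i (σ (q ℕ.* p ℕ.+ b) i)
    forward q {b} i 1≤b b≤p le with straight-or-hit q i 1≤b b≤p | b ℕ.≟ p
    ... | inj₁ v | _ = inj₁ v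
    ... | inj₂ (l , u≡ , inj₁ (l<q , t≡p)) | yes refl = inj₂ (spoilt-multiple t≡p (ℕ.<⇒≤ l<q) le u≡)
    ... | inj₂ (l , u≡ , inj₂ (l≡q , t≡p)) | yes refl = inj₂ (spoilt-multiple t≡p (ℕ.≤-reflexive l≡q) le u≡)
    -- If both orders were blocked, u would have offset l p as well as b + l′ p, impossible for 0 <
    -- b < p.
    forward (suc q) {b} i 1≤b b≤p le | inj₂ (l , u≡ , inj₁ (l<q , t≡p)) | no b≢p
      with remainder-first-or-hit q i 1≤b b≤p (λ (_ , b≡t) → b≢p (trans b≡t t≡p))
    ... | inj₁ v = inj₁ v
    ... | inj₂ (l′ , l′≤q , u≡′ , _) = contradiction
            (same-offset (ℕ.≤-trans (ℕ.*-monoˡ-≤ p (ℕ.<⇒≤ l<q)) (ℕ.m+n≤o⇒m≤o (suc q ℕ.* p) le))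
              (ℕ.≤-trans (ℕ.+-monoʳ-≤ b (ℕ.*-monoˡ-≤ p (ℕ.≤-trans l′≤q (ℕ.n≤1+n q))))
                (ℕ.≤-trans (ℕ.≤-reflexive (ℕ.+-comm b _)) le)) u≡ u≡′)
            (no-remainder l l′ 1≤b (ℕ.≤∧≢⇒< b≤p b≢p))
    -- The arc is the deleted link itself: overshoot to p places, then return by p - b.
    forward zero {b} i 1≤b b≤p le | inj₂ (_ , u≡ , inj₂ (refl , t≡b)) | no b≢p = inj₂
      ( 0 , 0 , refl , inj₁ refl , trans i≡u (sym (σ-N u))
      , trans (cong₂ σ (sym t≡b) i≡u) (sym (σ-0 w))
      , near-kept 1≤p ℕ.≤-refl (λ (_ , p≡t) → b≢p (trans (sym t≡b) (sym p≡t))) ∷ (symm H back ∷ []) )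
      where
      i≡u : i ≡ u
      i≡u = sym (trans u≡ (σ-0 i))
      back : Adj H (σ b i) (σ p i)
      back = subst (Adj H (σ b i)) (trans (σ-σ (p ∸ b) b i) (σ-cong i (ℕ.m+[n∸m]≡n b≤p)))
        (near-kept (ℕ.m<n⇒0<n∸m (ℕ.≤∧≢⇒< b≤p b≢p)) (ℕ.m∸n≤m p b)
          λ (eq , _) → σ-moves 1≤b (≤n⇒<N le) (trans i≡u (sym eq)))
    -- The deleted link is the final one and has length b < p. Taken first, the short link starts at
    -- i, which is not u.
    forward (suc q) {b} i 1≤b b≤p le | inj₂ (_ , u≡ , inj₂ (refl , t≡b)) | no b≢p
      with remainder-first-or-hit q i 1≤b b≤p (λ (i≡u , _) →
             σ-moves (ℕ.≤-trans 1≤p (ℕ.m≤m+n p _)) (≤n⇒<N (ℕ.m+n≤o⇒m≤o (suc q ℕ.* p) le)) (trans i≡u u≡))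
    ... | inj₁ v = inj₁ v
    ... | inj₂ (_ , _ , _ , t≡p) = contradiction (trans (sym t≡b) t≡p) b≢p

    -- Crossing may come first or last, and the two routes run along opposite arcs. If both met the
    -- deleted link, u would lie less than n places ahead of j and also between n and 2 n places
    -- ahead.
    crossing : ∀ {a d} i → a ℕ.≤ n → n ℕ.≤ a ℕ.+ d ℕ.* p → ∃ λ e → e ℕ.≤ suc d × Walk H e i (σ a i)
    crossing {a} {d} i a≤n le with n ∸ a ℕ.≟ 0
    ... | yes c≡0 = 1 , s≤s z≤n , subst (Walk H 1 i) (σ-cong i n≡a) (opposite-kept ∷ [])
      where
      n≡a : n ≡ a
      n≡a = ℕ.≤-antisym (ℕ.m∸n≡0⇒m≤n c≡0) a≤n
    ... | no  c≢0 with q , b , c≡ , 1≤b , b≤p ← split p 1≤p (ℕ.n≢0⇒n>0 c≢0) = route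
      where
      c = n ∸ a
      j = σ a i

      q<d : q ℕ.< d
      q<d = quotient-< 1≤b c≡ (ℕ.m≤n+o⇒m∸n≤o n a le)

      σcj≡σni : σ (q ℕ.* p ℕ.+ b) j ≡ σ n i
      σcj≡σni = trans (σ-σ _ a i) (σ-cong i (trans (cong (a ℕ.+_) (sym c≡)) (ℕ.m+[n∸m]≡n a≤n)))

      σcσnj≡i : σ (q ℕ.* p ℕ.+ b) (σ n j) ≡ i
      σcσnj≡i = trans (σ-comm _ n j) (trans (cong (σ n) σcj≡σni) (σ-n-n i))

      offset<n : ∀ {l} → l ℕ.≤ q → l ℕ.* p ℕ.< n
      offset<n l≤q = ℕ.≤-<-trans (ℕ.*-monoˡ-≤ p l≤q)
        (ℕ.<-≤-trans (ℕ.m<m+n (q ℕ.* p) 1≤b) (ℕ.≤-trans (ℕ.≤-reflexive (sym c≡)) (ℕ.m∸n≤m n a)))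

      route : ∃ λ e → e ℕ.≤ suc d × Walk H e i j
      route with straight-or-hit q j 1≤b b≤p
      ... | inj₁ v = suc (suc q) , s≤s q<d ,
              opposite-kept ∷ reverse (subst (Walk H (suc q) j) σcj≡σni v)
      ... | inj₂ (l , u≡ , r) with straight-or-hit q (σ n j) 1≤b b≤p
      ...   | inj₁ v = suc (suc q) , s≤s q<d ,
                reverse (opposite-kept ∷ subst (Walk H (suc q) (σ n j)) σcσnj≡i v)
      ...   | inj₂ (l′ , u≡′ , r′) = contradiction
                (σ-free (≤n⇒<N (ℕ.<⇒≤ (offset<n (index r)))) (n+<N (offset<n (index r′)))
                  (trans (sym u≡) (trans u≡′ (σ-σ (l′ ℕ.* p) n j))))
                (ℕ.<⇒≢ (ℕ.<-≤-trans (offset<n (index r)) (ℕ.m≤m+n n _)))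
        where
        index : ∀ {l A B} → (l ℕ.< q × A) ⊎ (l ≡ q × B) → l ℕ.≤ q
        index = [ ℕ.<⇒≤ ∘ proj₁ , ℕ.≤-reflexive ∘ proj₁ ]′

    module _ (k : ℕ) (k-max : ∀ m → m ℕ.* (2 ℕ.* p) ℕ.< n ℕ.+ p → m ℕ.≤ k) where

      -- The inequality with d says that a crossing walk of d + 1 links is ruled out. For b = p it
      -- gives (2 q + 1) p < n, which is the condition of `k-max` for q + 1; for q = 0 it suffices
      -- that 2 p < n + p.
      index-bound : ∀ {q b d} → q ≡ 0 ⊎ b ≡ p → q ℕ.≤ d → q ℕ.* p ℕ.+ b ℕ.+ d ℕ.* p ℕ.< n → q ℕ.< k
      index-bound (inj₁ refl) _ _ = k-max 1 (subst (ℕ._< n ℕ.+ p)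
        (solve 1 (λ p → p :+ p := con 1 :* (con 2 :* p)) refl p) (ℕ.+-monoˡ-< p p<n))
        where open ℕ.+-*-Solver
      index-bound {q} {d = d} (inj₂ refl) q≤d lt = k-max (suc q) (begin-strict
        suc q ℕ.* (2 ℕ.* p)
          ≡⟨ solve 2 (λ q p → (con 1 :+ q) :* (con 2 :* p) := ((q :* p :+ p) :+ q :* p) :+ p) refl q p ⟩
        q ℕ.* p ℕ.+ p ℕ.+ q ℕ.* p ℕ.+ p
          ≤⟨ ℕ.+-monoˡ-≤ p (ℕ.+-monoʳ-≤ (q ℕ.* p ℕ.+ p) (ℕ.*-monoˡ-≤ p q≤d)) ⟩
        q ℕ.* p ℕ.+ p ℕ.+ d ℕ.* p ℕ.+ p
          <⟨ ℕ.+-monoˡ-< p lt ⟩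
        n ℕ.+ p ∎)
        where
        open ℕ.≤-Reasoning
        open ℕ.+-*-Solver

      penalty : ℕ → ℕ → ℚ
      penalty x y = 2^- suc (suc (x ℕ.+ y))

      detour-ahead : ∀ {d i a} → a ℕ.≤ n → i ≢ σ a i → Walk G d i (σ a i) →
                     Detour k (before u) (after w) H penalty d i (σ a i)
      detour-ahead {i = i} {zero} a≤n i≢ v = contradiction (sym (σ-0 i)) i≢
      detour-ahead {i = i} {a@(suc _)} a≤n i≢ v
        with walk-bound a≤n v | split p 1≤p {a} (s≤s z≤n)
      ... | inj₂ (d , refl , le) | _ = inj₁ (crossing i a≤n le)
      ... | inj₁ a≤dp | q , b , a≡ , 1≤b , b≤p =
              choose (quotient-< 1≤b a≡ a≤dp)
        where
        choose : ∀ {d} → q ℕ.< d → Detour k (before u) (after w) H penalty d i (σ a i)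
        choose {suc d} (s≤s q≤d) with n ℕ.≤? a ℕ.+ d ℕ.* p
        -- A crossing route is preferred whenever it is no longer than the given walk, so that only
        -- arcs with index below k can be charged.
        ... | yes le = inj₁ (crossing i a≤n le)
        ... | no ¬le = subst (λ c → Detour k (before u) (after w) H penalty (suc d) i (σ c i)) (sym a≡)
                (relabel (forward q i 1≤b b≤p (subst (ℕ._≤ n) a≡ a≤n)))
          where
          relabel : Walk H (suc q) i (σ (q ℕ.* p ℕ.+ b) i) ⊎ Spoilt q b i (σ (q ℕ.* p ℕ.+ b) i) →
                    Detour k (before u) (after w) H penalty (suc d) i (σ (q ℕ.* p ℕ.+ b) i)
          relabel (inj₁ v) = inj₁ (suc q , s≤s q≤d , v)
          relabel (inj₂ (x , y , refl , r , i≡ , j≡ , v)) = inj₂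
            ( x , y , (index-bound r q≤d (subst (λ c → c ℕ.+ d ℕ.* p ℕ.< n) a≡ (ℕ.≰⇒> ¬le)) , inj₁ (i≡ , j≡))
            , suc (suc q) , v
            -- The penalty equals the weight of the detour, and together they make 2^-(q+1).
            , subst (2^- suc d ≤_) (sym (half+half (2^- suc q))) (2^-antitone (s≤s q≤d)))

      detour : ∀ {d i j} → i ≢ j → Walk G d i j → Detour k (before u) (after w) H penalty d i j
      detour {i = i} {j} i≢j v with short-gap i j
      ... | inj₁ (a , a≤n , refl) = detour-ahead a≤n i≢j v
      ... | inj₂ (a , a≤n , refl) = Detour-sym k (before u) (after w) (detour-ahead a≤n (i≢j ∘ sym) (reverse v))

      -- Each pair is charged 2^-(x+y+2) in both orders. The bound is independent of t and so covers
      -- the links shorter than p as well.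
      near-loss : C G ≤ C H + triangle k (λ x y → 2^- suc (x ℕ.+ y))
      near-loss = subst (λ z → C G ≤ C H + z) (triangle-cong k λ x y → half+half (2^- suc (x ℕ.+ y)))
        (C-loss k (before u) (after w) G H penalty (λ x y → 2^-nonNeg (suc (suc (x ℕ.+ y)))) detour)

  -- Deleting a link between opposite vertices

  module DeletedOpposite (u : Fin N) (H : Graph N)
    (keep : ∀ {i j} → Adj G i j → ¬ ((i ≡ u × j ≡ σ n u) ⊎ (i ≡ σ n u × j ≡ u)) → Adj H i j) where

    near-kept : ∀ {t i} → 1 ℕ.≤ t → t ℕ.≤ p → Adj H i (σ t i)
    near-kept {t} {i} 1≤t t≤p = keep (adj-near 1≤t t≤p) λ
      { (inj₁ (refl , eq)) → ℕ.<⇒≢ t<n (σ-free (ℕ.<-trans t<n n<N) n<N eq)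
      ; (inj₂ (refl , eq)) → σ-moves (ℕ.≤-trans 1≤t (ℕ.m≤n+m t n)) (n+<N t<n)
          (trans (sym eq) (σ-σ t n u)) }
      where
      t<n : t ℕ.< n
      t<n = ℕ.≤-<-trans t≤p p<n

    Deleted : Fin N → Set
    Deleted i = i ≡ u ⊎ i ≡ σ n u

    opposite-kept : ∀ {i} → ¬ Deleted i → Adj H i (σ n i)
    opposite-kept other = keep adj-opposite λ
      { (inj₁ (eq , _)) → other (inj₁ eq) ; (inj₂ (eq , _)) → other (inj₂ eq) }

    deleted-offset : ∀ {a i} → a ℕ.< N → Deleted i → Deleted (σ a i) → a ≡ 0 ⊎ a ≡ n
    deleted-offset {i = i} a<N (inj₁ refl) (inj₁ eq) =
      inj₁ (σ-free a<N (ℕ.≤-<-trans z≤n n<N) (trans eq (sym (σ-0 i))))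
    deleted-offset a<N (inj₁ refl) (inj₂ eq) = inj₂ (σ-free a<N n<N eq)
    deleted-offset a<N (inj₂ refl) (inj₁ eq) = inj₂ (σ-free a<N n<N (trans eq (sym (σ-n-n u))))
    deleted-offset a<N (inj₂ refl) (inj₂ eq) =
      inj₁ (σ-free a<N (ℕ.≤-<-trans z≤n n<N) (trans eq (sym (σ-0 (σ n u)))))

    -- The ends of the deleted link pass from distance 1 to distance at most 3.
    penalty : ℚ
    penalty = 2^- 1 - 2^- 3

    Outcome : ℕ → Fin N → Fin N → Set
    Outcome = Detour 1 (λ _ → u) (λ _ → σ n u) H (λ _ _ → penalty)

    around-deleted : ∀ {d i} → 1 ℕ.≤ d → Deleted i → Outcome d i (σ n i)
    around-deleted {d} {i} 1≤d del = inj₂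
      ( 0 , 0 , (s≤s z≤n , ends del) , 3
      -- One place ahead, across and one place back; `side` shows that this crossing is not the
      -- deleted one.
      , (near-kept ℕ.≤-refl 1≤p ∷ (opposite-kept side ∷ (symm H last ∷ [])))
      , 2^-antitone 1≤d )
      where
      ends : Deleted i → (i ≡ u × σ n i ≡ σ n u) ⊎ (i ≡ σ n u × σ n i ≡ u)
      ends (inj₁ refl) = inj₁ (refl , refl)
      ends (inj₂ refl) = inj₂ (refl , σ-n-n u)
      side : ¬ Deleted (σ 1 i)
      side del′ with deleted-offset (≤n⇒<N (ℕ.≤-trans 1≤p (ℕ.<⇒≤ p<n))) del del′
      ... | inj₂ 1≡n = ℕ.<⇒≢ (ℕ.<-trans 1<p p<n) 1≡n
      last : Adj H (σ n i) (σ n (σ 1 i))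
      last = subst (Adj H (σ n i)) (σ-comm 1 n i) (near-kept ℕ.≤-refl 1≤p)

    crossing : ∀ {a d} i → 1 ℕ.≤ a → a ℕ.≤ n → n ℕ.≤ a ℕ.+ d ℕ.* p → Outcome (suc d) i (σ a i)
    crossing {a} {d} i 1≤a a≤n le with n ∸ a ℕ.≟ 0 | (i Fin.≟ u) ⊎-dec (i Fin.≟ σ n u)
    ... | yes c≡0 | del? = subst (λ c → Outcome (suc d) i (σ c i))
            (ℕ.≤-antisym (ℕ.m∸n≡0⇒m≤n c≡0) a≤n) (direct del?)
      where
      direct : Dec (Deleted i) → Outcome (suc d) i (σ n i)
      direct (yes del) = around-deleted (s≤s z≤n) del
      direct (no ¬del) = inj₁ (1 , s≤s z≤n , opposite-kept ¬del ∷ [])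
    ... | no  c≢0 | del? with q , b , c≡ , 1≤b , b≤p ← split p 1≤p (ℕ.n≢0⇒n>0 c≢0) =
            inj₁ (suc (suc q) , s≤s q<d , route del?)
      where
      c = n ∸ a
      j = σ a i

      q<d : q ℕ.< d
      q<d = quotient-< 1≤b c≡ (ℕ.m≤n+o⇒m∸n≤o n a le)

      σcj≡σni : σ (q ℕ.* p ℕ.+ b) j ≡ σ n i
      σcj≡σni = trans (σ-σ _ a i) (σ-cong i (trans (cong (a ℕ.+_) (sym c≡)) (ℕ.m+[n∸m]≡n a≤n)))

      σcσnj≡i : σ (q ℕ.* p ℕ.+ b) (σ n j) ≡ i
      σcσnj≡i = trans (σ-comm _ n j) (trans (cong (σ n) σcj≡σni) (σ-n-n i))

      route : Dec (Deleted i) → Walk H (suc (suc q)) i j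
      route (no ¬del) = opposite-kept ¬del ∷
        reverse (subst (Walk H (suc q) j) σcj≡σni (straight H near-kept q j 1≤b b≤p))
      -- The crossing at i is deleted, so the crossing at j is used: since 0 < a < n, j is not an
      -- end of the deleted link.
      route (yes del) = reverse (opposite-kept ¬del ∷
        subst (Walk H (suc q) (σ n j)) σcσnj≡i (straight H near-kept q (σ n j) 1≤b b≤p))
        where
        ¬del : ¬ Deleted j
        ¬del del′ with deleted-offset (≤n⇒<N a≤n) del del′
        ... | inj₁ refl = contradiction 1≤a λ ()
        ... | inj₂ refl = c≢0 (ℕ.n∸n≡0 n)

    outcome-ahead : ∀ {d i a} → a ℕ.≤ n → i ≢ σ a i → Walk G d i (σ a i) → Outcome d i (σ a i)
    outcome-ahead {i = i} {zero} a≤n i≢ v = contradiction (sym (σ-0 i)) i≢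
    outcome-ahead {i = i} {a@(suc _)} a≤n i≢ v
      with walk-bound a≤n v | split p 1≤p {a} (s≤s z≤n)
    ... | inj₂ (d , refl , le) | _ = crossing i (s≤s z≤n) a≤n le
    ... | inj₁ a≤dp | q , b , a≡ , 1≤b , b≤p =
            inj₁ (suc q , quotient-< 1≤b a≡ a≤dp ,
              subst (Walk H (suc q) i) (σ-cong i (sym a≡)) (straight H near-kept q i 1≤b b≤p))

    outcome : ∀ {d i j} → i ≢ j → Walk G d i j → Outcome d i j
    outcome {i = i} {j} i≢j v with short-gap i j
    ... | inj₁ (a , a≤n , refl) = outcome-ahead a≤n i≢j v
    ... | inj₂ (a , a≤n , refl) = Detour-sym 1 (λ _ → u) (λ _ → σ n u) (outcome-ahead a≤n (i≢j ∘ sym) (reverse v))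

    opposite-loss : C G ≤ C H + triangle 1 (λ _ _ → penalty + penalty)
    opposite-loss = C-loss 1 (λ _ → u) (λ _ → σ n u) G H (λ _ _ → penalty) (λ _ _ → ℚ.nonNegative⁻¹ penalty) outcome

-- The exact cost of deleting a link of length p

m∸n≤o⇒m≤n+o : ∀ m n {o} → m ∸ n ℕ.≤ o → m ℕ.≤ n ℕ.+ o
m∸n≤o⇒m≤n+o m n le = ℕ.≤-trans (ℕ.m≤n+m∸n m n) (ℕ.+-monoʳ-≤ n le)

module DeletedLongest (p n : ℕ) (1<p : 1 ℕ.< p) (3p<n : 3 ℕ.* p ℕ.< n) 
  (k : ℕ) (k-min : k ℕ.* (2 ℕ.* p) ℕ.< n ℕ.+ p) where

  open Paths p n 1<p 3p<n

  -- This excludes crossing walks of m + 1 links between vertices (m + 1) p places apart.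
  span<n : ∀ {m} → suc m ℕ.≤ k → suc m ℕ.* p ℕ.+ m ℕ.* p ℕ.< n
  span<n {m} 1+m≤k = ℕ.+-cancelʳ-< p _ n (begin-strict
    suc m ℕ.* p ℕ.+ m ℕ.* p ℕ.+ p
      ≡⟨ solve 2 (λ m p → (con 1 :+ m) :* p :+ m :* p :+ p := (con 1 :+ m) :* (con 2 :* p)) refl m p ⟩
    suc m ℕ.* (2 ℕ.* p)   ≤⟨ ℕ.*-monoˡ-≤ (2 ℕ.* p) 1+m≤k ⟩
    k ℕ.* (2 ℕ.* p)       <⟨ k-min ⟩
    n ℕ.+ p               ∎)
    where
    open ℕ.≤-Reasoning
    open ℕ.+-*-Solver

  multiple≤n : ∀ {m} → m ℕ.≤ k → m ℕ.* p ℕ.≤ n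
  multiple≤n {zero}  _     = z≤n
  multiple≤n {suc m} 1+m≤k = ℕ.≤-trans (ℕ.m≤m+n _ (m ℕ.* p)) (ℕ.<⇒≤ (span<n 1+m≤k))

  multiple-bound : ∀ {m e i} → suc m ℕ.≤ k → Walk G e i (σ (suc m ℕ.* p) i) → suc m ℕ.≤ e
  multiple-bound {m} {e} 1+m≤k v with walk-bound (multiple≤n 1+m≤k) v
  ... | inj₁ le = ℕ.*-cancelʳ-≤ (suc m) e p {{>-nonZero 1≤p}} le
  ... | inj₂ (e′ , refl , le) = ℕ.≮⇒≥ λ e<1+m → ℕ.<⇒≱ (span<n 1+m≤k)
          (ℕ.≤-trans le (ℕ.+-monoʳ-≤ (suc m ℕ.* p) (ℕ.*-monoˡ-≤ p (ℕ.≤-trans (ℕ.n≤1+n e′) (ℕ.≤-pred e<1+m)))))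

  -- Any other first link leaves a gap that m links cannot cover: along the circle only p places
  -- ahead leave as little as m p, and `span<n` excludes crossing.
  geodesic-step : ∀ {m i i′} → suc m ℕ.≤ k → Adj G i i′ → Walk G m i′ (σ (suc m ℕ.* p) i) → i′ ≡ σ p i
  geodesic-step {m} {i} {i′} 1+m≤k e v = by (step e)
    where
    A = suc m ℕ.* p

    p≤A : p ℕ.≤ A
    p≤A = ℕ.m≤m+n p (m ℕ.* p)

    too-long : ∀ {x} → n ℕ.≤ x → x ℕ.≤ A ℕ.+ m ℕ.* p → i′ ≡ σ p i
    too-long n≤x x≤ = contradiction (ℕ.≤-trans n≤x x≤) (ℕ.<⇒≱ (span<n 1+m≤k))

    t+A≤n : ∀ {m} → suc m ℕ.≤ k → p ℕ.+ suc m ℕ.* p ℕ.≤ n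
    -- `walk-bound` requires a gap of at most n. For m = 0 the gap is at most 2 p, and 3 p < n is
    -- used.
    t+A≤n {zero} _ = ℕ.≤-trans (ℕ.+-monoʳ-≤ p (ℕ.+-monoʳ-≤ p z≤n)) (ℕ.<⇒≤ 3p<n)
    t+A≤n {suc m} lt = ℕ.≤-trans (ℕ.≤-trans (ℕ.+-monoˡ-≤ _ (ℕ.m≤m+n p (m ℕ.* p)))
      (ℕ.≤-reflexive (ℕ.+-comm (suc m ℕ.* p) _))) (ℕ.<⇒≤ (span<n lt))

    by : Step i i′ → i′ ≡ σ p i
    by (ahead {t} 1≤t t≤p refl)
      with walk-bound (ℕ.≤-trans (ℕ.m∸n≤m A t) (multiple≤n 1+m≤k))
             (subst (Walk G m (σ t i)) (trans (σ-cong i (sym (ℕ.m+[n∸m]≡n (ℕ.≤-trans t≤p p≤A)))) (sym (σ-σ (A ∸ t) t i))) v)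
    ... | inj₁ le = σ-cong i (ℕ.≤-antisym t≤p
            (ℕ.+-cancelʳ-≤ (m ℕ.* p) p t (m∸n≤o⇒m≤n+o A t le)))
    ... | inj₂ (m′ , refl , le) = too-long le (ℕ.+-mono-≤ (ℕ.m∸n≤m A t) (ℕ.m≤n+m (m′ ℕ.* p) p))
    by (behind {t} 1≤t t≤p refl)
      with walk-bound (ℕ.≤-trans (ℕ.+-monoˡ-≤ A t≤p) (t+A≤n 1+m≤k)) (subst (Walk G m i′) (σ-σ A t i′) v)
    ... | inj₁ le = contradiction (ℕ.≤-trans (ℕ.m≤n+m A t) le) (ℕ.<⇒≱ (ℕ.m<n+m (m ℕ.* p) 1≤p))
    ... | inj₂ (m′ , refl , le) = too-long le (ℕ.≤-trans
            (ℕ.+-monoˡ-≤ (m′ ℕ.* p) (ℕ.+-monoˡ-≤ A t≤p))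
            (ℕ.≤-reflexive (trans (cong (ℕ._+ m′ ℕ.* p) (ℕ.+-comm p A)) (ℕ.+-assoc A p (m′ ℕ.* p)))))
    -- The remaining walk is reversed, so that its gap is the n - A places from the target to the
    -- vertex opposite i.
    by (opposite refl)
      with walk-bound (ℕ.m∸n≤m n A)
             (subst (Walk G m (σ A i)) (trans (σ-cong i (sym (ℕ.m+[n∸m]≡n (multiple≤n 1+m≤k)))) (sym (σ-σ (n ∸ A) A i))) (reverse v))
    ... | inj₁ le = too-long (m∸n≤o⇒m≤n+o n A le) ℕ.≤-refl
    ... | inj₂ (m′ , refl , le) = contradiction le (ℕ.<⇒≱ (begin-strict
            n ∸ A ℕ.+ m′ ℕ.* p   <⟨ ℕ.+-monoʳ-< (n ∸ A) (ℕ.<-≤-trans (ℕ.m<n+m (m′ ℕ.* p) 1≤p) (ℕ.m≤n+m (suc m′ ℕ.* p) p)) ⟩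
            n ∸ A ℕ.+ A          ≡⟨ ℕ.m∸n+n≡m (multiple≤n 1+m≤k) ⟩
            n                    ∎))
      where open ℕ.≤-Reasoning

  module _ (u : Fin N) where

    w : Fin N
    w = σ p u

    H : Graph N
    H = deleteLink G u w

    after-≡ : ∀ x y {i} → u ≡ σ (x ℕ.* p) i → after w y ≡ σ (suc (x ℕ.+ y) ℕ.* p) i
    after-≡ x y {i} u≡ = begin
      σ (y ℕ.* p) (σ p u)                      ≡⟨ σ-σ (y ℕ.* p) p u ⟩
      σ (p ℕ.+ y ℕ.* p) u                      ≡⟨ cong (σ _) u≡ ⟩
      σ (p ℕ.+ y ℕ.* p) (σ (x ℕ.* p) i)        ≡⟨ σ-σ _ (x ℕ.* p) i ⟩
      σ (x ℕ.* p ℕ.+ (p ℕ.+ y ℕ.* p)) i        ≡⟨ σ-cong i (solve 3 (λ x y p →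
        x :* p :+ (p :+ y :* p) := (con 1 :+ (x :+ y)) :* p) refl x y p) ⟩
      σ (suc (x ℕ.+ y) ℕ.* p) i                ∎
      where
      open ≡-Reasoning
      open ℕ.+-*-Solver

    -- Induction on x. A walk of only x + y + 1 links in `H` is a shortest walk of `G` and so begins
    -- with p places ahead. For x = 0 that is the deleted link; otherwise the rest is too short for
    -- the case x - 1.
    detour-bound : ∀ x {y e i} → x ℕ.+ y ℕ.< k → u ≡ σ (x ℕ.* p) i → Walk H e i (after w y) →
                   suc (suc (x ℕ.+ y)) ℕ.≤ e
    detour-bound x {y} {e} {i} lt u≡ v
      with ℕ.m≤n⇒m<n∨m≡n (multiple-bound lt (subst (Walk G e i) (after-≡ x y u≡) (map-walk proj₁ v)))
    ... | inj₁ longer = longer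
    detour-bound x {y} {i = i} lt u≡ (_∷_ {j = i′} e v) | inj₂ refl = via x refl lt u≡ v
      where
      i′≡ : i′ ≡ σ p i
      i′≡ = geodesic-step lt (proj₁ e) (subst (Walk G (x ℕ.+ y) i′) (after-≡ x y u≡) (map-walk proj₁ v))

      via : ∀ x₁ → x ≡ x₁ → x₁ ℕ.+ y ℕ.< k → u ≡ σ (x₁ ℕ.* p) i → Walk H (x₁ ℕ.+ y) i′ (after w y) →
            suc (suc (x ℕ.+ y)) ℕ.≤ suc (x ℕ.+ y)
      via zero _ lt u≡ v = contradiction (inj₁ (i≡u , trans i′≡ (cong (σ p) i≡u))) (proj₂ e)
        where
        i≡u : i ≡ u
        i≡u = sym (trans u≡ (σ-0 i))
      via (suc x₁) _ lt u≡ v = contradiction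
        (detour-bound x₁ (ℕ.<-trans (ℕ.n<1+n _) lt)
          (trans u≡ (trans (sym (σ-σ (x₁ ℕ.* p) p i)) (cong (σ (x₁ ℕ.* p)) (sym i′≡)))) v)
        (ℕ.<⇒≱ (ℕ.n<1+n _))

    penalty : ℕ → ℕ → ℚ
    penalty x y = 2^- suc (suc (x ℕ.+ y))

    before-≡ : ∀ {x} → x ℕ.< k → u ≡ σ (x ℕ.* p) (before u x)
    before-≡ x<k = sym (σ-forth u (ℕ.≤-trans (multiple≤n (ℕ.<⇒≤ x<k)) (ℕ.<⇒≤ n<N)))

    -- The distance is at most x + y + 1 in `G` and at least x + y + 2 in `H`; halving 2^-(x+y+1)
    -- loses exactly `penalty`.
    weight-gap : ∀ {x y i j} → Listed k (before u) (after w) x y i j →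
                 weight H i j + penalty x y ≤ weight G i j
    weight-gap {x} {y} {i} {j} (lt , ends) = ℚ.≤-trans
      (ℚ.+-monoˡ-≤ (penalty x y) (weight-elim H (2^-nonNeg (suc (suc (x ℕ.+ y)))) λ v → 2^-antitone (long ends v)))
      (ℚ.≤-trans (ℚ.≤-reflexive (half+half (2^- suc (x ℕ.+ y)))) (walk⇒≤weight G (short ends)))
      where
      u≡ : u ≡ σ (x ℕ.* p) (before u x)
      u≡ = before-≡ (ℕ.≤-<-trans (ℕ.m≤m+n x y) lt)

      Ends : Set
      Ends = (i ≡ before u x × j ≡ after w y) ⊎ (i ≡ after w y × j ≡ before u x)

      long : Ends → ∀ {d} → Walk H d i j → suc (suc (x ℕ.+ y)) ℕ.≤ d
      long (inj₁ (refl , refl)) v = detour-bound x lt u≡ v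
      long (inj₂ (refl , refl)) v = detour-bound x lt u≡ (reverse v)

      direct : Walk G (suc (x ℕ.+ y)) (before u x) (after w y)
      direct = subst (Walk G (suc (x ℕ.+ y)) (before u x))
        (trans (σ-cong _ (ℕ.+-comm ((x ℕ.+ y) ℕ.* p) p)) (sym (after-≡ x y u≡)))
        (straight G adj-near (x ℕ.+ y) (before u x) 1≤p ℕ.≤-refl)

      short : Ends → Walk G (suc (x ℕ.+ y)) i j
      short (inj₁ (refl , refl)) = direct
      short (inj₂ (refl , refl)) = reverse direct

    multiple-injective : ∀ {x y i} → x ℕ.< k → y ℕ.< k → σ (x ℕ.* p) i ≡ σ (y ℕ.* p) i → x ≡ y
    multiple-injective {x} {y} x<k y<k eq = ℕ.*-cancelʳ-≡ x y p {{>-nonZero 1≤p}}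
      (σ-free (≤n⇒<N (multiple≤n (ℕ.<⇒≤ x<k))) (≤n⇒<N (multiple≤n (ℕ.<⇒≤ y<k))) eq)

    -- The forward gap is (x + y + 1) p, which is positive and less than a full turn.
    before≢after : ∀ {x y} → x ℕ.< k → y ℕ.< k → before u x ≢ after w y
    before≢after {x} {y} x<k y<k eq = σ-moves
      (ℕ.≤-trans 1≤p (ℕ.m≤m+n p _)) small (trans eq (after-≡ x y (before-≡ x<k)))
      where
      small : suc (x ℕ.+ y) ℕ.* p ℕ.< N
      small = <n+n⇒<N (subst (ℕ._< n ℕ.+ n)
        (solve 3 (λ x y p → (con 1 :+ x) :* p :+ y :* p := (con 1 :+ (x :+ y)) :* p) refl x y p)
        (ℕ.+-mono-≤-< (multiple≤n x<k) (ℕ.<-≤-trans (ℕ.m<n+m (y ℕ.* p) 1≤p) (multiple≤n y<k))))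
        where open ℕ.+-*-Solver

    -- The inequality opposite to `near-loss` for t = p, so this deletion costs exactly the
    -- triangular sum.
    longest-gain : C H + triangle k (λ x y → 2^- suc (x ℕ.+ y)) ≤ C G
    longest-gain = subst (λ z → C H + z ≤ C G) (triangle-cong k λ x y → half+half (2^- suc (x ℕ.+ y)))
      (C-gain k (before u) (after w) G H penalty
        (λ x y → cong (λ z → 2^- suc (suc z)) (ℕ.+-comm x y))
        -- Equal `before` vertices reach the same u after x p and y p places, so distinctness of the
        -- multiples of p applies again.
        (λ x<k y<k eq → multiple-injective x<k y<k
          (trans (sym (before-≡ x<k)) (trans (before-≡ y<k) (cong (σ _) (sym eq)))))
        multiple-injective
        before≢after
        (λ i j → weight-elim H (weight-nonNeg G i j) λ v → walk⇒≤weight G (map-walk proj₁ v))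
        (λ {x} {y} → weight-gap {x} {y}))

-- The minimum over all links

ℚ-+-cancelʳ-≤ : ∀ z {x y} → x + z ≤ y + z → x ≤ y
ℚ-+-cancelʳ-≤ z {x} {y} le = subst₂ _≤_ (cancel x z) (cancel y z) (ℚ.+-monoˡ-≤ (- z) le)
  where
  cancel : ∀ x z → x + z + - z ≡ x
  cancel = solve 2 (λ x z → (x :+ z) :+ :- z := x) refl
    where open +-*-Solver

-- Membership of v makes the list nonempty, so the default value 0 of `minimum` does not arise.
minimum-≡ : ∀ {x v xs} → v ∈ xs → v ≤ x → (∀ {y} → y ∈ xs → x ≤ y) → minimum xs ≡ x
minimum-≡ {x} {v} {y ∷ ys} v∈ v≤x lower = ℚ.≤-antisym
  (ℚ.≤-trans (min≤ v∈) v≤x)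
  (v≤min⁺ (lower (here refl)) (All.tabulate (lower ∘ there)))
  where
  open Extrema (DecTotalOrder.totalOrder ℚ.≤-decTotalOrder)
  min≤ : v ∈ y ∷ ys → minimum (y ∷ ys) ≤ v
  min≤ (here refl) = min≤⊤ y ys
  min≤ (there v∈)  = All.lookup (min≤xs y ys) v∈

R-≡ : ∀ {N} (G : Graph N) {x} → (∃₂ λ r s → Adj G r s × C (deleteLink G r s) ≤ x) →
      (∀ {r s} → Adj G r s → x ≤ C (deleteLink G r s)) → R G ≡ x
R-≡ {N} G {x} (r , s , e , le) lower = minimum-≡
  (∈-map⁺ cost (∈-filter⁺ link? (∈-cartesianProduct⁺ (∈-allFin r) (∈-allFin s)) e)) le bound
  where
  link? : ∀ (rs : Fin N × Fin N) → Dec (Adj G (proj₁ rs) (proj₂ rs))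
  link? (r , s) = adj? G r s
  cost : Fin N × Fin N → ℚ
  cost (r , s) = C (deleteLink G r s)
  bound : ∀ {y} → y ∈ map cost (links G) → x ≤ y
  bound y∈ with ∈-map⁻ cost y∈
  ... | (r , s) , rs∈ , refl = lower (proj₂ (∈-filter⁻ link? {xs = cartesianProduct (allFin N) (allFin N)} rs∈))

-- The first two entries ½ and ¼ of the row x = 0 already pay for an opposite link.
¾≤triangle : ∀ {k} → 2 ℕ.≤ k → + 3 / 4 ≤ triangle k (λ x y → 2^- suc (x ℕ.+ y))
¾≤triangle {suc (suc k)} _ = begin
  ½ + ½ * ½                  ≤⟨ ℚ.+-monoʳ-≤ ½ (x≤x+y (½ * ½) (sum-nonNeg {k} λ y → 2^-nonNeg (suc (suc (suc (toℕ y)))))) ⟩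
  sum {suc (suc k)} (λ y → 2^- suc (toℕ y))
    ≤⟨ x≤x+y _ (sum-nonNeg {suc k} λ x → sum-nonNeg {suc k ∸ toℕ x} λ y → 2^-nonNeg (suc (suc (toℕ x) ℕ.+ toℕ y))) ⟩
  triangle (suc (suc k)) (λ x y → 2^- suc (x ℕ.+ y)) ∎
  where open ℚ.≤-Reasoning
¾≤triangle {suc zero} (s≤s ())

theorem5 : (p n : ℕ) (p>1 : p > 1) → n ≥ 3 ℕ.* p ℕ.+ 1 →
    let k = ℕ._/_ (n ℕ.+ p ∸ 1) (2 ℕ.* p) {{2*p-nonZero p>1}} in
    R (Harary p n) ≡ (C (Harary p n) - (+ 2 / 1)) + (+ (k ℕ.+ 2) / 1) * (2^- k)
theorem5 p n p>1 n≥ = R-≡ G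
  -- Every link of length p attains the minimum; the one at vertex 0 is taken. Both bounds are
  -- compared after adding `L`.
  ( o , σ p o , adj-near 1≤p ℕ.≤-refl
  , ℚ-+-cancelʳ-≤ L (subst (C (deleteLink G o (σ p o)) + L ≤_) (sym value+L) (longest-gain o)) )
  λ {r} {s} e → ℚ-+-cancelʳ-≤ L (subst (_≤ C (deleteLink G r s) + L) (sym value+L) (loss (step e)))
  where
  instance
    2p≢0 : NonZero (2 ℕ.* p)
    2p≢0 = 2*p-nonZero p>1

  3p<n : 3 ℕ.* p ℕ.< n
  3p<n = subst (ℕ._≤ n) (ℕ.+-comm (3 ℕ.* p) 1) n≥

  k : ℕ
  k = (n ℕ.+ p ∸ 1) ℕ./ (2 ℕ.* p)

  n+p≡ : suc (n ℕ.+ p ∸ 1) ≡ n ℕ.+ p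
  n+p≡ = ℕ.m+[n∸m]≡n (ℕ.≤-trans (ℕ.<⇒≤ p>1) (ℕ.m≤n+m p n))

  -- As the floor of (n + p - 1) / (2 p), k is the largest m with 2 p m < n + p; `k-min` and `k-max`
  -- are the two halves of this.
  k-min : k ℕ.* (2 ℕ.* p) ℕ.< n ℕ.+ p
  k-min = subst (k ℕ.* (2 ℕ.* p) ℕ.<_) n+p≡ (s≤s (m/n*n≤m (n ℕ.+ p ∸ 1) (2 ℕ.* p)))

  k-max : ∀ m → m ℕ.* (2 ℕ.* p) ℕ.< n ℕ.+ p → m ℕ.≤ k
  k-max m lt = subst (ℕ._≤ k) (m*n/n≡m m (2 ℕ.* p))
    (/-monoˡ-≤ (2 ℕ.* p) (ℕ.≤-pred (subst (m ℕ.* (2 ℕ.* p) ℕ.<_) (sym n+p≡) lt)))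

  2≤k : 2 ℕ.≤ k
  2≤k = k-max 2 (subst (ℕ._< n ℕ.+ p)
    (solve 1 (λ p → con 3 :* p :+ p := con 2 :* (con 2 :* p)) refl p) (ℕ.+-monoˡ-< p 3p<n))
    where open ℕ.+-*-Solver

  open Paths p n p>1 3p<n
  open DeletedLongest p n p>1 3p<n k k-min

  o : Fin N
  o = fromℕ< (ℕ.≤-<-trans z≤n n<N)

  L tail : ℚ
  L = triangle k (λ x y → 2^- suc (x ℕ.+ y))
  tail = (+ (k ℕ.+ 2) / 1) * 2^- k

  value+L : (C G - (+ 2 / 1)) + tail + L ≡ C G
  value+L = begin
    (C G - (+ 2 / 1)) + tail + L
      ≡⟨ solve 4 (λ c z t l → ((c :- z) :+ t) :+ l := (c :- z) :+ (l :+ t)) refl (C G) (+ 2 / 1) tail L ⟩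
    (C G - (+ 2 / 1)) + (L + tail)  ≡⟨ cong (_+_ (C G - (+ 2 / 1))) (triangle-2^- k) ⟩
    (C G - (+ 2 / 1)) + (+ 2 / 1)   ≡⟨ solve 2 (λ c z → (c :- z) :+ z := c) refl (C G) (+ 2 / 1) ⟩
    C G                             ∎
    where
    open ≡-Reasoning
    open +-*-Solver

  loss : ∀ {r s} → Step r s → C G ≤ C (deleteLink G r s) + L
  loss {r} {s} (ahead 1≤t t≤p refl) =
    DeletedNear.near-loss 1≤t t≤p r (deleteLink G r s) _,_ k k-max
  -- The same link seen from s, so the two orientations of the deleted link are exchanged.
  loss {r} {s} (behind 1≤t t≤p refl) =
    DeletedNear.near-loss 1≤t t≤p s (deleteLink G r s)
      (λ e other → e , λ { (inj₁ rs) → other (inj₂ rs) ; (inj₂ sr) → other (inj₁ sr) }) k k-max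
  loss {r} {s} (opposite refl) = ℚ.≤-trans
    (DeletedOpposite.opposite-loss r (deleteLink G r s) _,_)
    (ℚ.+-monoʳ-≤ (C (deleteLink G r s)) (¾≤triangle 2≤k))
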